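{- Let $l_1\leq l_2\leq\cdots\leq l_m$ be positive integers and $L=l_1+\cdots+l_m+1$. Let $\epsilon_m$ be the sequence of length $2(l_1+\cdots+l_m)$ formed by concatenating $2m$ blocks, where for $r=1,\dots,2m$ the $r$-th block consists of the entry $(-1)^{r-1}$ repeated $n_r$ times, with block lengths $(n_1,\dots,n_{2m})=(l_m,l_{m-1},\dots,l_1,l_1,l_2,\dots,l_m)$. Then there is a bijection between the following two sets: ($\alpha$) the set of pairs $(\sigma,<)$, where $\sigma$ is a non-crossing pairing compatible with $\epsilon_m$ and $<$ is a total order on the vertices of the quotient tree $T_\sigma$ compatible with the orientations of the edges; ($\beta$) the set of tuples $(B_1,\dots,B_m)$ of pairwise disjoint sets with $B_1\cup\cdots\cup B_m=\{1,\dots,L\}$ such that $|B_1|+\cdots+|B_n|\leq l_1+\cdots+l_n$ for each $1\leq n\leq m-1$. (Equivalently, ($\beta$) is in bijection, via $B_j=\{k: a_k=j\}$, with the set of sequences $(a_1,\dots,a_L)\in\{1,\dots,m\}^L$ such that for each $1\leq n\leq m-1$ at most $l_1+\cdots+l_n$ terms of the sequence lie in $\{1,\dots,n\}$.)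
   Context: For $\epsilon=(\epsilon(1),\dots,\epsilon(k))\in\{ -1,+1\}^k$, let $G_\epsilon$ be the oriented $k$-gon with vertices $v_1,\dots,v_k$ and edges $e_1,\dots,e_k$, where $e_i$ joins $v_i$ and $v_{i+1}$ (with $v_{k+1}:=v_1$); $e_i$ is oriented from $v_{i+1}$ to $v_i$ if $\epsilon(i)=+1$ and from $v_i$ to $v_{i+1}$ if $\epsilon(i)=-1$. A pairing $\sigma$ of $\{1,\dots,k\}$ is a partition into 2-element blocks; it is compatible with $\epsilon$ if $\epsilon(i)+\epsilon(j)=0$ for every $\{i,j\}\in\sigma$, and non-crossing if there are no $p<q<r<s$ with $\{p,r\},\{q,s\}\in\sigma$. The quotient graph $T_\sigma$ is obtained from $G_\epsilon$ by gluing, for each $\{i,j\}\in\sigma$, edge $e_i$ to edge $e_j$ so that $v_i$ is identified with $v_{j+1}$ and $v_{i+1}$ with $v_j$ (vertex identifications generated by these); each edge of $T_\sigma$ inherits the common orientation of the two edges it comes from. For non-crossing $\sigma$, $T_\sigma$ is a tree. For vertices $x,y$ write $x\prec y$ if there is a nonempty directed path from $y$ to $x$ following the arrows. A total order $<$ on the vertices of $T_\sigma$ is compatible with the orientations of the edges if $x\prec y$ implies $x<y$. -}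

module Defs where

open import Level using (0ℓ) renaming (suc to lsuc)
open import Data.Nat as ℕ using (ℕ; zero; suc; s≤s; _+_; _*_)
open import Data.Fin as Fin using (Fin; toℕ; fromℕ<)
open import Data.Fin.Subset using (Subset; _∈_; _∉_; ∣_∣)
open import Data.Integer as ℤ using (ℤ; 0ℤ; 1ℤ; -1ℤ)
open import Data.List as List using (List; length; lookup; concat; replicate; zip; upTo; allFin; filter; reverse; _++_)
open import Data.Nat.ListAction using (sum)
open import Data.Product using (Σ; ∃; ∃-syntax; _×_; _,_)
open import Data.Sum using (_⊎_)
open import Relation.Nullary using (¬_; yes; no)
open import Relation.Binary.Core using (Rel)
open import Relation.Binary.Bundles using (Setoid)
open import Relation.Binary.PropositionalEquality using (_≡_; _≢_; refl; sym; trans)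
open import Relation.Binary.Construct.Closure.Equivalence using (EqClosure)
open import Relation.Binary.Construct.Closure.Transitive using (TransClosure)
open import Function.Bundles using (_⇔_; mk⇔; Equivalence)

-- Oriented k-gon, pairings, quotient tree (generic k)
-- Indices are 0-based: vertex v_{i+1} of the paper is (i : Fin k),
-- edge e_{i+1} of the paper is (i : Fin k), joining i and next i.

next : ∀ {k} → Fin k → Fin k
next {suc n} i with toℕ i ℕ.<? n
... | yes p = fromℕ< (s≤s p)
... | no _  = Fin.zero

-- A pairing of {1..k} encoded by its partner map: σ i is the other
-- element of the block containing i (fixed-point-free involution).
IsPairing : ∀ {k} → (Fin k → Fin k) → Set
IsPairing σ = (∀ i → σ (σ i) ≡ i) × (∀ i → σ i ≢ i)

Compatible : ∀ {k} → (Fin k → ℤ) → (Fin k → Fin k) → Set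
Compatible ε σ = ∀ i → ε i ℤ.+ ε (σ i) ≡ 0ℤ

NonCrossing : ∀ {k} → (Fin k → Fin k) → Set
NonCrossing {k} σ = ¬ (Σ (Fin k) λ p → Σ (Fin k) λ q → Σ (Fin k) λ r → Σ (Fin k) λ s →
  p Fin.< q × q Fin.< r × r Fin.< s × σ p ≡ r × σ q ≡ s)

-- generating identifications: for the block {i , σ i}, v_i ~ v_{σ i + 1}
-- (and, taking the block as {σ i , i}, v_{i+1} ~ v_{σ i}).
data Glue {k} (σ : Fin k → Fin k) : Rel (Fin k) 0ℓ where
  glue : ∀ i → Glue σ i (next (σ i))

-- two vertices of G_ε become the same vertex of T_σ
_∼[_]_ : ∀ {k} → Fin k → (Fin k → Fin k) → Fin k → Set
x ∼[ σ ] y = EqClosure (Glue σ) x y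

data Arrow {k} (ε : Fin k → ℤ) : Rel (Fin k) 0ℓ where
  plusE  : ∀ i → ε i ≡ 1ℤ  → Arrow ε (next i) i
  minusE : ∀ i → ε i ≡ -1ℤ → Arrow ε i (next i)

ArrowT : ∀ {k} → (Fin k → ℤ) → (Fin k → Fin k) → Rel (Fin k) 0ℓ
ArrowT ε σ x y = Σ _ λ a → Σ _ λ b → x ∼[ σ ] a × Arrow ε a b × b ∼[ σ ] y

Prec : ∀ {k} → (Fin k → ℤ) → (Fin k → Fin k) → Rel (Fin k) 0ℓ
Prec ε σ x y = TransClosure (ArrowT ε σ) y x

-- A strict total order on the vertices of T_σ, given on representatives
-- (vertices of G_ε) and well defined on classes, compatible with orientations.
record CompatibleOrder {k} (ε : Fin k → ℤ) (σ : Fin k → Fin k)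
                       (_<_ : Rel (Fin k) 0ℓ) : Set where
  field
    respects   : ∀ {x x′ y y′} → x ∼[ σ ] x′ → y ∼[ σ ] y′ → x < y → x′ < y′
    irrefl     : ∀ {x y} → x ∼[ σ ] y → ¬ (x < y)
    transitive : ∀ {x y z} → x < y → y < z → x < z
    trichotomy : ∀ x y → (x < y) ⊎ (x ∼[ σ ] y) ⊎ (y < x)
    compatible : ∀ {x y} → Prec ε σ x y → x < y

-- The data of Theorem 1.4  (l : Fin m → ℕ,  l i = l_{i+1})

blockLengths : ∀ {m} → (Fin m → ℕ) → List ℕ
blockLengths {m} l = reverse (List.map l (allFin m)) ++ List.map l (allFin m)

epsList : ∀ {m} → (Fin m → ℕ) → List ℤ
epsList {m} l = concat (List.map (λ { (r , n) → replicate n (-1ℤ ℤ.^ r) })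
                                  (zip (upTo (2 * m)) (blockLengths l)))

K : ∀ {m} → (Fin m → ℕ) → ℕ
K l = length (epsList l)

εm : ∀ {m} (l : Fin m → ℕ) → Fin (K l) → ℤ
εm l = lookup (epsList l)

sumL : ∀ {m} → (Fin m → ℕ) → ℕ
sumL {m} l = sum (List.map l (allFin m))

sumBelow : ∀ {m} → (Fin m → ℕ) → ℕ → ℕ
sumBelow {m} f n = sum (List.map f (filter (λ j → toℕ j ℕ.<? n) (allFin m)))

Lsize : ∀ {m} → (Fin m → ℕ) → ℕ
Lsize l = sumL l + 1

record Alpha {m} (l : Fin m → ℕ) : Set₁ where
  field
    σ        : Fin (K l) → Fin (K l)
    pairing  : IsPairing σ
    compat   : Compatible (εm l) σ
    noncross : NonCrossing σ
    order    : Rel (Fin (K l)) 0ℓ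
    isOrder  : CompatibleOrder (εm l) σ order

record Beta {m} (l : Fin m → ℕ) : Set where
  field
    B         : Fin m → Subset (Lsize l)
    disjoint  : ∀ i j → i ≢ j → ∀ x → x ∈ B i → x ∉ B j
    covering  : ∀ x → ∃[ j ] x ∈ B j
    bounded   : ∀ n → 1 ℕ.≤ n → n ℕ.< m →
                sumBelow (λ j → ∣ B j ∣) n ℕ.≤ sumBelow l n

_≈α_ : ∀ {m} {l : Fin m → ℕ} → Rel (Alpha l) 0ℓ
a ≈α b = (∀ i → Alpha.σ a i ≡ Alpha.σ b i) ×
         (∀ x y → Alpha.order a x y ⇔ Alpha.order b x y)

_≈β_ : ∀ {m} {l : Fin m → ℕ} → Rel (Beta l) 0ℓ
a ≈β b = ∀ j → Beta.B a j ≡ Beta.B b j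

AlphaSetoid : ∀ {m} (l : Fin m → ℕ) → Setoid (lsuc 0ℓ) 0ℓ
AlphaSetoid l = record
  { Carrier = Alpha l
  ; _≈_ = _≈α_
  ; isEquivalence = record
    { refl  = (λ _ → refl) , (λ _ _ → mk⇔ (λ z → z) (λ z → z))
    ; sym   = λ (p , q) → (λ i → sym (p i)) ,
                (λ x y → mk⇔ (Equivalence.from (q x y)) (Equivalence.to (q x y)))
    ; trans = λ (p , q) (p′ , q′) → (λ i → trans (p i) (p′ i)) ,
                (λ x y → mk⇔ (λ z → Equivalence.to (q′ x y) (Equivalence.to (q x y) z))
                             (λ z → Equivalence.from (q x y) (Equivalence.from (q′ x y) z)))
    }
  }

BetaSetoid : ∀ {m} (l : Fin m → ℕ) → Setoid 0ℓ 0ℓ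
BetaSetoid l = record
  { Carrier = Beta l
  ; _≈_ = _≈β_
  ; isEquivalence = record
    { refl  = λ _ → refl
    ; sym   = λ p j → sym (p j)
    ; trans = λ p q j → trans (p j) (q j)
    }
  }

{-# OPTIONS --safe #-}

-- Walking around a plane tree whose vertices carry the labels 1, …, L, write U when the label
-- grows and D when it drops.  The pairs (σ, <) are the labelled plane trees with contour word ε_m.
--
-- Hang such a tree below an extra vertex t preceding all labels, and let t climb.  At all times one
-- has a path of unglued letters U and D, every corner of which carries t, with labelled trees
-- hanging at its corners.  When t passes a child y, the edge U … D towards y is unglued, so that y
-- becomes a corner of the path, and the valley D … U preceding it is glued, its vertex receiving the
-- label y; if there is no preceding valley, y is released and the path has grown by one U and one D.
-- Valleys and peaks of the path alternate, so the step can be undone once it is known whether y was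
-- released.  The contour word never changes.
--
-- When t is above all labels, the children of t are read as D … U, hence the prefix U^l and the
-- suffix D^l (l = l_m + 1) consist of unglued letters.  What is left between them is a configuration
-- of the same kind, with the opposite orientation, for l_1, …, l_{m-1}; so let t descend again, and
-- so on.  B_j is the set of labels released in the stage of l_j, and the inequalities for the |B_j|
-- say that there are always enough unglued letters to be stripped off.
module Submission where

open import Defs
open import Data.Nat using (ℕ; zero; suc; _+_; _*_; _∸_; _≤_; _<_; z≤n; s≤s; _<ᵇ_; _<?_; _≤?_)
open import Data.Nat.Properties hiding (_≟_; _<?_; _≤?_)
open import Data.Nat.ListAction using (sum)
open import Data.Nat.Solver using (module +-*-Solver)
open +-*-Solver using (solve; _:+_; _:*_; _:=_; con)
open import Data.Fin as Fin using (Fin; toℕ; fromℕ<)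
open import Data.Fin.Properties using (_≟_; toℕ-injective; toℕ-fromℕ<; toℕ<n; pigeonhole)
import Data.Fin.Properties as Fin
open import Data.Fin.Subset using (Subset; ∣_∣) renaming (_∈_ to _∈ₛ_)
open import Data.Integer as ℤ using (ℤ; 0ℤ; 1ℤ; -1ℤ)
open import Data.Bool using (Bool; true; false; not; if_then_else_; T)
open import Data.List using (List; []; _∷_; _++_; _∷ʳ_; map; length; lookup; replicate; reverse; _ʳ++_; concat; zip; applyUpTo; upTo; downFrom; allFin; tabulate; filter; initLast; _∷ʳ′_)
open import Data.List.Properties
open import Data.List.Membership.Propositional using (_∈_; _∉_)
open import Data.List.Membership.Propositional.Properties using (∈-++⁺ˡ; ∈-++⁺ʳ; ∈-++⁻; ∈-lookup)
open import Data.List.Relation.Unary.All as All using (All; []; _∷_)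
import Data.List.Relation.Unary.All.Properties as All
open import Data.List.Relation.Unary.AllPairs using (AllPairs; []; _∷_)
import Data.List.Relation.Unary.AllPairs.Properties as AllPairs
open import Data.List.Relation.Unary.Any using (here; there)
open import Data.List.Relation.Unary.Any.Properties using (reverse⁺)
open import Data.List.Relation.Unary.Unique.Propositional using (Unique)
open import Data.Vec as Vec using ([]; _∷_)
import Data.Vec.Properties as Vec
open import Data.Product using (∃; ∃₂; _×_; _,_; proj₁; proj₂)
open import Data.Sum using (_⊎_; inj₁; inj₂)
open import Data.Unit using (⊤; tt)
open import Data.Empty using (⊥; ⊥-elim)
open import Function using (_∘_; const; id; _⇔_; mk⇔; Equivalence)
open import Function.Bundles using (Bijection)
open import Relation.Nullary using (¬_; yes; no; does; contradiction; Dec)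
open import Relation.Nullary.Decidable using (dec-true; dec-false)
open import Relation.Unary using (Decidable)
open import Relation.Binary using (tri<; tri≈; tri>)
open import Relation.Binary.PropositionalEquality
import Relation.Binary.Construct.Closure.Equivalence as EqC
open import Relation.Binary.Construct.Closure.Transitive using (TransClosure; [_]; _∷_)

-- Before each stage the word of the configuration, read with the current orientation, is the word
-- of the remaining blocks. Since the block lengths decrease weakly, this word stays above its
-- starting height and returns to it, so the path has equally many free `U` and free `D`. If u is
-- this number before the stage of a block of length n, and u′ the number after the stripping, then
-- |B_j| + u = n + u′. Both the first and the last u are 0. Adding the identities over the stages of
-- l_k, ..., l_1 gives |B_1| + ... + |B_k| + u = l_1 + ... + l_k for k < m: these are the
-- inequalities of (β), and conversely the inequalities make every u a natural number. The
-- additional letter of the first block makes the grand total L, as it has to be: the last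
-- configuration is empty, so every label is released exactly once.
--
-- The height condition is also what makes a step reversible. A path that has just risen must come
-- down again, and the `D` that it then meets is the one from which the peak towards the label is
-- rebuilt.

-- Labelled plane trees, paths with hanging trees, and their contour words.

data Letter : Set where
  U D : Letter

op : Letter → Letter
op U = D
op D = U

op-involutive : ∀ a → op (op a) ≡ a
op-involutive U = refl
op-involutive D = refl

data Tree (A : Set) : Set where
  node : A → List (Tree A) → Tree A

Forest : Set → Set
Forest A = List (Tree A)

data Item (A : Set) : Set where
  ltr : Letter → Item A
  tr  : Tree A → Item A

State : Set → Set
State A = List (Item A)

-- In wordF and word, d tells whether the edge to a root starts with D; c y plays the role of d for
-- the children of y.
opening closing : Bool → Letter
opening b = if b then D else U
closing b = op (opening b)

wordF : ∀ {A : Set} → (A → A → Bool) → (A → Bool) → Forest A → List Letter → List Letter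
wordF c d []               k = k
wordF c d (node y cs ∷ ts) k = opening (d y) ∷ wordF c (c y) cs (closing (d y) ∷ wordF c d ts k)

word : ∀ {A : Set} → (A → A → Bool) → (A → Bool) → State A → List Letter
word c d []           = []
word c d (ltr a ∷ s)  = a ∷ word c d s
word c d (tr t ∷ s)   = wordF c d (t ∷ []) (word c d s)

wordF-++ : ∀ {A : Set} (c : A → A → Bool) (d : A → Bool) F k k′ →
  wordF c d F (k ++ k′) ≡ wordF c d F k ++ k′
wordF-++ c d []               k k′ = refl
wordF-++ c d (node y cs ∷ ts) k k′ = cong (opening (d y) ∷_)
  (trans (cong (λ v → wordF c (c y) cs (closing (d y) ∷ v)) (wordF-++ c d ts k k′))
         (wordF-++ c (c y) cs (closing (d y) ∷ wordF c d ts k) k′))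

word-prepend : ∀ {A : Set} (c : A → A → Bool) (d : A → Bool) F s →
  word c d (map tr F ++ s) ≡ wordF c d F (word c d s)
word-prepend c d []               s = refl
word-prepend c d (node y cs ∷ ts) s =
  cong (λ v → opening (d y) ∷ wordF c (c y) cs (closing (d y) ∷ v)) (word-prepend c d ts s)

wordF-cong : ∀ {A : Set} (c : A → A → Bool) {d d′ : A → Bool} → (∀ z → d z ≡ d′ z) →
  ∀ F k → wordF c d F k ≡ wordF c d′ F k
wordF-cong c eq []               k = refl
wordF-cong c eq (node y cs ∷ ts) k rewrite eq y | wordF-cong c eq ts k = refl

word-cong : ∀ {A : Set} (c : A → A → Bool) {d d′ : A → Bool} → (∀ z → d z ≡ d′ z) →
  ∀ s → word c d s ≡ word c d′ s
word-cong c eq []          = refl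
word-cong c eq (ltr a ∷ s) = cong (a ∷_) (word-cong c eq s)
word-cong c {d} {d′} eq (tr t ∷ s) rewrite word-cong c eq s = wordF-cong c eq (t ∷ []) _

-- The opposite orientation

opItem : ∀ {A : Set} → Item A → Item A
opItem (ltr a) = ltr (op a)
opItem (tr t)  = tr t

opItem-involutive : ∀ {A : Set} (i : Item A) → opItem (opItem i) ≡ i
opItem-involutive (ltr a) = cong ltr (op-involutive a)
opItem-involutive (tr t)  = refl

opening-not : ∀ b → opening b ≡ op (opening (not b))
opening-not false = refl
opening-not true  = refl

wordF-op : ∀ {A : Set} (c : A → A → Bool) (d : A → Bool) F k →
  wordF c d F (map op k) ≡ map op (wordF (λ y z → not (c y z)) (not ∘ d) F k)
wordF-op c d []               k = refl
wordF-op c d (node y cs ∷ ts) k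
  rewrite wordF-op c d ts k | opening-not (d y) = cong (_ ∷_) (wordF-op c (c y) cs _)

word-op : ∀ {A : Set} (c : A → A → Bool) (d : A → Bool) s →
  word c d (map opItem s) ≡ map op (word (λ y z → not (c y z)) (not ∘ d) s)
word-op c d []          = refl
word-op c d (ltr a ∷ s) = cong (op a ∷_) (word-op c d s)
word-op c d (tr t ∷ s) rewrite word-op c d s = wordF-op c d (t ∷ []) _

-- Dyck paths

Dyck : ℕ → List Letter → Set
Dyck h       []      = h ≡ 0
Dyck h       (U ∷ w) = Dyck (suc h) w
Dyck zero    (D ∷ w) = ⊥
Dyck (suc h) (D ∷ w) = Dyck h w

dyck-wordF : ∀ {A : Set} (c : A → A → Bool) (d : A → Bool) F k {h} →
  Dyck h (wordF c d F k) → Dyck h k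
dyck-wordF c d []               k dy = dy
dyck-wordF c d (node y cs ∷ ts) k {h} dy with d y
... | false = dyck-wordF c d ts k (dyck-wordF c (c y) cs _ dy)
dyck-wordF c d (node y cs ∷ ts) k {suc h} dy | true =
  dyck-wordF c d ts k (dyck-wordF c (c y) cs _ dy)

ups downs : ∀ {A : Set} → State A → ℕ
ups []              = 0
ups (ltr U ∷ s)     = suc (ups s)
ups (ltr D ∷ s)     = ups s
ups (tr _ ∷ s)      = ups s
downs []            = 0
downs (ltr U ∷ s)   = downs s
downs (ltr D ∷ s)   = suc (downs s)
downs (tr _ ∷ s)    = downs s

ups-++ : ∀ {A : Set} (s s′ : State A) → ups (s ++ s′) ≡ ups s + ups s′
ups-++ []          s′ = refl
ups-++ (ltr U ∷ s) s′ = cong suc (ups-++ s s′)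
ups-++ (ltr D ∷ s) s′ = ups-++ s s′
ups-++ (tr _ ∷ s)  s′ = ups-++ s s′

ups-prepend : ∀ {A : Set} (F : Forest A) s → ups (map tr F ++ s) ≡ ups s
ups-prepend []      s = refl
ups-prepend (_ ∷ F) s = ups-prepend F s

ups-op : ∀ {A : Set} (s : State A) → ups (map opItem s) ≡ downs s
ups-op []          = refl
ups-op (ltr U ∷ s) = ups-op s
ups-op (ltr D ∷ s) = cong suc (ups-op s)
ups-op (tr _ ∷ s)  = ups-op s

dyck-balanced : ∀ {A : Set} (c : A → A → Bool) (d : A → Bool) s {h} →
  Dyck h (word c d s) → h + ups s ≡ downs s
dyck-balanced c d []          {h} dy = trans (+-identityʳ h) dy
dyck-balanced c d (ltr U ∷ s) {h} dy = trans (+-suc h _) (dyck-balanced c d s dy)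
dyck-balanced c d (ltr D ∷ s) {suc h} dy = cong suc (dyck-balanced c d s dy)
dyck-balanced c d (tr t ∷ s)  dy = dyck-balanced c d s (dyck-wordF c d (t ∷ []) _ dy)

-- Occurrences of labels

⟦_⟧ : Bool → ℕ
⟦ b ⟧ = if b then 1 else 0

sumOver : ∀ {X : Set} → (X → ℕ) → List X → ℕ
sumOver f []       = 0
sumOver f (x ∷ xs) = f x + sumOver f xs

sumOver-ʳ++ : ∀ {X : Set} (f : X → ℕ) xs acc → sumOver f (xs ʳ++ acc) ≡ sumOver f xs + sumOver f acc
sumOver-ʳ++ f []       acc = refl
sumOver-ʳ++ f (x ∷ xs) acc = trans (sumOver-ʳ++ f xs (x ∷ acc))
  (solve 3 (λ a b e → a :+ (b :+ e) := b :+ a :+ e) refl (sumOver f xs) (f x) (sumOver f acc))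

sumOver-reverse : ∀ {X : Set} (f : X → ℕ) xs → sumOver f (reverse xs) ≡ sumOver f xs
sumOver-reverse f xs = trans (sumOver-ʳ++ f xs []) (+-identityʳ _)

module _ {L : ℕ} where

  private A = Fin L

  δ : A → A → ℕ
  δ y z = ⟦ does (y ≟ z) ⟧

  δ-refl : ∀ y → δ y y ≡ 1
  δ-refl y rewrite dec-true (y ≟ y) refl = refl

  δ-≢ : ∀ {y z} → y ≢ z → δ y z ≡ 0
  δ-≢ {y} {z} y≢z rewrite dec-false (y ≟ z) y≢z = refl

  countF : A → Forest A → ℕ
  countF y []               = 0
  countF y (node z cs ∷ ts) = δ y z + (countF y cs + countF y ts)

  count : A → State A → ℕ
  count y []          = 0
  count y (ltr _ ∷ s) = count y s
  count y (tr t ∷ s)  = countF y (t ∷ []) + count y s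

  count-prepend : ∀ y F s → count y (map tr F ++ s) ≡ countF y F + count y s
  count-prepend y []               s = refl
  count-prepend y (node z cs ∷ ts) s rewrite count-prepend y ts s | +-identityʳ (countF y cs)
    | +-assoc (δ y z) (countF y cs + countF y ts) (count y s)
    | +-assoc (countF y cs) (countF y ts) (count y s)
    | +-assoc (δ y z) (countF y cs) (countF y ts + count y s) = refl

  count-++ : ∀ y s s′ → count y (s ++ s′) ≡ count y s + count y s′
  count-++ y []          s′ = refl
  count-++ y (ltr _ ∷ s) s′ = count-++ y s s′
  count-++ y (tr t ∷ s)  s′ rewrite count-++ y s s′ = sym (+-assoc (countF y (t ∷ [])) _ _)

  count-op : ∀ y s → count y (map opItem s) ≡ count y s
  count-op y []          = refl
  count-op y (ltr _ ∷ s) = count-op y s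
  count-op y (tr t ∷ s)  = cong (countF y (t ∷ []) +_) (count-op y s)

  -- Only roots are tested: a label deeper in a tree is not adjacent to the extra vertex, and
  -- passing it changes nothing.
  Off : A → Item A → Set
  Off y (ltr _)         = ⊤
  Off y (tr (node z _)) = z ≢ y

  δ≡0⇒≢ : ∀ {y z} → δ y z ≡ 0 → z ≢ y
  δ≡0⇒≢ {y} p refl rewrite δ-refl y = contradiction p λ ()

  offF : ∀ y F → countF y F ≡ 0 → All (Off y) (map tr F)
  offF y []               p = []
  offF y (node z cs ∷ ts) p = δ≡0⇒≢ (m+n≡0⇒m≡0 (δ y z) p)
    ∷ offF y ts (m+n≡0⇒n≡0 (countF y cs) (m+n≡0⇒n≡0 (δ y z) p))

  off : ∀ y s → count y s ≡ 0 → All (Off y) s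
  off y []                  p = []
  off y (ltr _ ∷ s)         p = tt ∷ off y s p
  off y (tr (node z cs) ∷ s) p =
    δ≡0⇒≢ (m+n≡0⇒m≡0 (δ y z) (m+n≡0⇒m≡0 (δ y z + _) p)) ∷ off y s (m+n≡0⇒n≡0 (δ y z + _) p)

  -- The predicate `d` is consulted at roots only; below a root `z` the letters are governed by
  -- `c z`. Hence occurrences of `y` deeper down do no harm.
  wordF-off : ∀ c {d d′ : A → Bool} y → (∀ z → z ≢ y → d z ≡ d′ z) →
    ∀ F k → All (Off y) (map tr F) → wordF c d F k ≡ wordF c d′ F k
  wordF-off c y eq []               k []       = refl
  wordF-off c y eq (node z cs ∷ ts) k (o ∷ os)
    rewrite eq z o | wordF-off c y eq ts k os = refl

  word-off : ∀ c {d d′ : A → Bool} y → (∀ z → z ≢ y → d z ≡ d′ z) →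
    ∀ s → All (Off y) s → word c d s ≡ word c d′ s
  word-off c y eq []                   []       = refl
  word-off c y eq (ltr a ∷ s)          (_ ∷ os) = cong (a ∷_) (word-off c y eq s os)
  word-off c y eq (tr (node z cs) ∷ s) (o ∷ os)
    rewrite eq z o | word-off c y eq s os = refl

  -- Moving the extra vertex past one label

  -- Pull y s S R: the peak towards y, found in s before any D, is unglued, and a valley is about to be
  -- glued that reaches from the D in front of s to the next U; S hangs inside it and R follows it.
  data Pull (y : A) : State A → Forest A → State A → Set where
    here : ∀ {cs xs} → Pull y (tr (node y cs) ∷ xs) [] (map tr cs ++ ltr D ∷ xs)
    past : ∀ {z cs xs S R} → z ≢ y → Pull y xs S R → Pull y (tr (node z cs) ∷ xs) (node z cs ∷ S) R
    rise : ∀ {xs S R} → Pull y xs S R → Pull y (ltr U ∷ xs) [] (map tr S ++ ltr U ∷ R)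

  -- `Pull` cannot cross a `D`, so `slide` happens at the last `D` in front of the root `y`. The
  -- `Off` in `skip` fixes the position of the move in both readings of the relation: forwards `y`
  -- is the leftmost such root, backwards it is the root of the first tree labelled `y`.
  data Move (y : A) : State A → State A → Set where
    slide : ∀ {xs S R} → Pull y xs S R → Move y (ltr D ∷ xs) (tr (node y S) ∷ R)
    skip  : ∀ {x xs xs′} → Off y x → Move y xs xs′ → Move y (x ∷ xs) (x ∷ xs′)

  -- The Boolean tells whether y is released.
  data Step (y : A) : Bool → State A → State A → Set where
    freed : ∀ {s S R} → Pull y s S R → Step y true s (map tr S ++ ltr U ∷ R)
    moved : ∀ {s s′} → Move y s s′ → Step y false s s′
    idle  : ∀ {s} → All (Off y) s → Step y false s s

  data Located (y : A) (s : State A) : Set where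
    pulled : ∀ {S R} → Pull y s S R → Located y s
    moving : ∀ {s′} → Move y s s′ → Located y s
    absent : All (Off y) s → Located y s

  locate : ∀ y s → Located y s
  locate y [] = absent []
  locate y (ltr U ∷ s) with locate y s
  ... | pulled p = pulled (rise p)
  ... | moving p = moving (skip tt p)
  ... | absent p = absent (tt ∷ p)
  locate y (ltr D ∷ s) with locate y s
  ... | pulled p = moving (slide p)
  ... | moving p = moving (skip tt p)
  ... | absent p = absent (tt ∷ p)
  locate y (tr (node z cs) ∷ s) with z ≟ y
  ... | yes refl = pulled here
  ... | no z≢y with locate y s
  ... | pulled p = pulled (past z≢y p)
  ... | moving p = moving (skip z≢y p)
  ... | absent p = absent (z≢y ∷ p)

  step-total : ∀ y s → ∃₂ λ b s′ → Step y b s s′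
  step-total y s with locate y s
  ... | pulled p = _ , _ , freed p
  ... | moving p = _ , _ , moved p
  ... | absent p = _ , _ , idle p

  pull-det : ∀ {y s S R S′ R′} → Pull y s S R → Pull y s S′ R′ → S ≡ S′ × R ≡ R′
  pull-det here       here       = refl , refl
  pull-det here       (past q _) = contradiction refl q
  pull-det (past q _) here       = contradiction refl q
  pull-det (past _ p) (past _ q) with refl , refl ← pull-det p q = refl , refl
  pull-det (rise p)   (rise q)   with refl , refl ← pull-det p q = refl , refl

  pull-move : ∀ {y s S R s′} → Pull y s S R → ¬ Move y s s′
  pull-move here       (skip q _) = q refl
  pull-move (past _ p) (skip _ q) = pull-move p q
  pull-move (rise p)   (skip _ q) = pull-move p q

  pull-off : ∀ {y s S R} → Pull y s S R → ¬ All (Off y) s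
  pull-off here       (q ∷ _) = q refl
  pull-off (past _ p) (_ ∷ q) = pull-off p q
  pull-off (rise p)   (_ ∷ q) = pull-off p q

  move-off : ∀ {y s s′} → Move y s s′ → ¬ All (Off y) s
  move-off (slide p)  (_ ∷ q) = pull-off p q
  move-off (skip _ p) (_ ∷ q) = move-off p q

  move-det : ∀ {y s s₁ s₂} → Move y s s₁ → Move y s s₂ → s₁ ≡ s₂
  move-det (slide p)  (slide q)  with refl , refl ← pull-det p q = refl
  move-det (slide p)  (skip _ q) = contradiction q (pull-move p)
  move-det (skip _ p) (slide q)  = contradiction p (pull-move q)
  move-det (skip _ p) (skip _ q) = cong (_ ∷_) (move-det p q)

  step-det : ∀ {y b b′ s s₁ s₂} → Step y b s s₁ → Step y b′ s s₂ → b ≡ b′ × s₁ ≡ s₂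
  step-det (freed p) (freed q) with refl , refl ← pull-det p q = refl , refl
  step-det (freed p) (moved q) = contradiction q (pull-move p)
  step-det (freed p) (idle q)  = contradiction q (pull-off p)
  step-det (moved p) (freed q) = contradiction p (pull-move q)
  step-det (moved p) (moved q) = refl , move-det p q
  step-det (moved p) (idle q)  = contradiction q (move-off p)
  step-det (idle p)  (freed q) = contradiction p (pull-off q)
  step-det (idle p)  (moved q) = contradiction p (move-off q)
  step-det (idle p)  (idle q)  = refl , refl

  split-at-letter : ∀ (S S′ : Forest A) {a a′} {R R′ : State A} →
    map tr S ++ ltr a ∷ R ≡ map tr S′ ++ ltr a′ ∷ R′ → S ≡ S′ × a ≡ a′ × R ≡ R′
  split-at-letter []      []       refl = refl , refl , refl
  split-at-letter (t ∷ S) (t′ ∷ S′) eq with refl , eq′ ← ∷-injective eq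
    with refl , refl , refl ← split-at-letter S S′ eq′ = refl , refl , refl

  -- Once `S` has been used up by `past`, the first letter of `R` tells how the pull went on: it is
  -- `D`, behind the children of `y`, for `here`, and `U` for `rise`.
  pull-codet : ∀ {y s s′ S R S′ R′} → Pull y s S R → Pull y s′ S′ R′ → S ≡ S′ → R ≡ R′ → s ≡ s′
  pull-codet (here {cs}) (here {cs′}) _ eq with refl , _ , refl ← split-at-letter cs cs′ eq = refl
  pull-codet (here {cs}) (rise {S = S} _) _ eq with _ , () , _ ← split-at-letter cs S eq
  pull-codet (rise {S = S} _) (here {cs}) _ eq with _ , () , _ ← split-at-letter S cs eq
  pull-codet (past _ p) (past _ q) refl eq = cong (_ ∷_) (pull-codet p q refl eq)
  pull-codet (rise {S = S} p) (rise {S = S′} q) _ eq with refl , _ , refl ← split-at-letter S S′ eq =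
    cong (_ ∷_) (pull-codet p q refl refl)

  move-codet : ∀ {y s₁ s₂ s s′} → Move y s₁ s → Move y s₂ s′ → s ≡ s′ → s₁ ≡ s₂
  move-codet (slide p)  (slide q)  refl = cong (_ ∷_) (pull-codet p q refl refl)
  move-codet (slide p)  (skip o q) refl = contradiction refl o
  move-codet (skip o p) (slide q)  refl = contradiction refl o
  move-codet (skip _ p) (skip _ q) refl = cong (_ ∷_) (move-codet p q refl)

  -- This separates the two kinds of step that release nothing: `moved` leaves `y` at a root, `idle`
  -- does not.
  move-on : ∀ {y s s′} → Move y s s′ → ¬ All (Off y) s′
  move-on (slide _)  (o ∷ _)  = o refl
  move-on (skip _ p) (_ ∷ os) = move-on p os

  step-codet : ∀ {y b s₁ s₂ s s′} → Step y b s₁ s → Step y b s₂ s′ → s ≡ s′ → s₁ ≡ s₂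
  step-codet (freed {S = S} p) (freed {S = S′} q) eq
    with refl , _ , refl ← split-at-letter S S′ eq = pull-codet p q refl refl
  step-codet (moved p) (moved q) refl = move-codet p q refl
  step-codet (moved p) (idle q)  refl = contradiction q (move-on p)
  step-codet (idle p)  (moved q) refl = contradiction p (move-on q)
  step-codet (idle p)  (idle q)  refl = refl

  pull-count : ∀ z {y s S R} → Pull y s S R → count z s ≡ δ z y + (countF z S + count z R)
  pull-count z {y} (here {cs} {xs}) rewrite count-prepend z cs (ltr D ∷ xs) | +-identityʳ (countF z cs) =
    +-assoc (δ z y) _ _
  pull-count z {y} (past {x} {cs} {xs} {S} {R} _ p)
    rewrite pull-count z p | +-identityʳ (countF z cs) =
    solve 5 (λ a b c e f → a :+ b :+ (c :+ (e :+ f)) := c :+ (a :+ (b :+ e) :+ f)) refl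
      (δ z x) (countF z cs) (δ z y) (countF z S) (count z R)
  pull-count z (rise {xs} {S} {R} p) rewrite count-prepend z S (ltr U ∷ R) = pull-count z p

  move-count : ∀ z {y s s′} → Move y s s′ → count z s ≡ count z s′
  move-count z {y} (slide {xs} {S} {R} p) rewrite +-identityʳ (countF z S) =
    trans (pull-count z p) (sym (+-assoc (δ z y) _ _))
  move-count z (skip {ltr _} _ p) = move-count z p
  move-count z (skip {tr t} _ p) = cong (countF z (t ∷ []) +_) (move-count z p)

  step-count : ∀ z {y b s s′} → Step y b s s′ → count z s ≡ (if b then δ z y else 0) + count z s′
  step-count z (freed {S = S} {R} p) rewrite count-prepend z S (ltr U ∷ R) = pull-count z p
  step-count z (moved p) = move-count z p
  step-count z (idle _)  = refl

  pull-ups : ∀ {y s S R} → Pull y s S R → ups s ≡ ups R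
  pull-ups (here {cs} {xs})    = sym (ups-prepend cs (ltr D ∷ xs))
  pull-ups (past _ p)          = pull-ups p
  pull-ups (rise {S = S} {R} p) = trans (cong suc (pull-ups p)) (sym (ups-prepend S (ltr U ∷ R)))

  move-ups : ∀ {y s s′} → Move y s s′ → ups s ≡ ups s′
  move-ups (slide p)          = pull-ups p
  move-ups (skip {ltr U} _ p) = cong suc (move-ups p)
  move-ups (skip {ltr D} _ p) = move-ups p
  move-ups (skip {tr _}  _ p) = move-ups p

  step-ups : ∀ {y b s s′} → Step y b s s′ → ups s′ ≡ ⟦ b ⟧ + ups s
  step-ups (freed {S = S} {R} p) = trans (ups-prepend S (ltr U ∷ R)) (cong suc (sym (pull-ups p)))
  step-ups (moved p)             = sym (move-ups p)
  step-ups (idle _)              = refl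

  -- Invariance of the contour word under a step, and the reversal of a step.

  -- `d` and `d′` record the labels already passed, just before and just after `y`. By `threshold`
  -- the extra vertex and `y` then compare in the same way with all other labels, so that a tree may
  -- change hands between them without any change of its letters.
  record Passes (c : A → A → Bool) (y : A) (d d′ : A → Bool) : Set where
    field
      threshold : ∀ z → z ≢ y → d z ≡ c y z
      above     : d y ≡ false
      others    : ∀ z → z ≢ y → d z ≡ d′ z
      below     : d′ y ≡ true

  1+n≤1⇒n≡0 : ∀ {m n} → m ≡ suc n → m ≤ 1 → n ≡ 0
  1+n≤1⇒n≡0 refl (s≤s z≤n) = refl

  pull-off-rest : ∀ {y : A} {s S R} → count y s ≤ 1 → Pull y s S R →
    All (Off y) (map tr S) × All (Off y) R
  pull-off-rest {y} {s} {S} {R} le p = offF y S (m+n≡0⇒m≡0 _ none) , off y R (m+n≡0⇒n≡0 (countF y S) none)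
    where
    none : countF y S + count y R ≡ 0
    none = 1+n≤1⇒n≡0 (trans (pull-count y p) (cong (_+ (countF y S + count y R)) (δ-refl y))) le

  module _ {c : A → A → Bool} {y : A} {d d′ : A → Bool} (ps : Passes c y d d′) where
    open Passes ps

    -- Just before `y` is passed, the edge towards it reads `U … D`. In `here` its `U` becomes the
    -- one announced behind `S`, and its children may be read from the extra vertex by `threshold`.
    -- In `rise` the announced `U` is the letter met on the path.
    pull-word : ∀ {s S R} → count y s ≤ 1 → Pull y s S R →
      word c d s ≡ wordF c d S (U ∷ word c d R)
    pull-word le p@(here {cs} {xs})
      rewrite above | word-prepend c d cs (ltr D ∷ xs) =
      cong (U ∷_) (wordF-off c y (λ z z≢y → sym (threshold z z≢y)) cs _
        (offF y cs (m+n≡0⇒m≡0 _ (m+n≡0⇒m≡0 (countF y cs + 0) none))))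
      where
      none : countF y cs + 0 + count y xs ≡ 0
      none = 1+n≤1⇒n≡0 (cong (λ v → v + (countF y cs + 0) + count y xs) (δ-refl y)) le
    pull-word le (past {z} {cs} _ p) =
      cong (λ v → opening (d z) ∷ wordF c (c z) cs (closing (d z) ∷ v))
        (pull-word (≤-trans (m≤n+m _ (countF y (node z cs ∷ []))) le) p)
    pull-word le (rise {xs} {S} {R} p) =
      cong (U ∷_) (trans (pull-word le p) (sym (word-prepend c d S (ltr U ∷ R))))

    move-word : ∀ {s s′} → count y s ≤ 1 → Move y s s′ → word c d s ≡ word c d′ s′
    move-word le (slide {xs} {S} {R} p) with offS , offR ← pull-off-rest le p
      rewrite below = cong (D ∷_) (begin
        word c d xs                        ≡⟨ pull-word le p ⟩
        wordF c d S (U ∷ word c d R)       ≡⟨ wordF-off c y threshold S _ offS ⟩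
        wordF c (c y) S (U ∷ word c d R)   ≡⟨ cong (λ v → wordF c (c y) S (U ∷ v)) (word-off c y others R offR) ⟩
        wordF c (c y) S (U ∷ word c d′ R)  ∎)
      where open ≡-Reasoning
    move-word le (skip {ltr a} _ p) = cong (a ∷_) (move-word le p)
    move-word le (skip {tr (node z cs)} o p)
      rewrite others z o | move-word (≤-trans (m≤n+m _ (countF y (node z cs ∷ []))) le) p = refl

    step-word : ∀ {b s s′} → count y s ≤ 1 → Step y b s s′ → word c d s ≡ word c d′ s′
    step-word le (freed {s} {S} {R} p) with offS , offR ← pull-off-rest le p = begin
      word c d s                        ≡⟨ pull-word le p ⟩
      wordF c d S (U ∷ word c d R)      ≡⟨ word-prepend c d S (ltr U ∷ R) ⟨
      word c d (map tr S ++ ltr U ∷ R)  ≡⟨ word-off c y others _ (All.++⁺ offS (tt ∷ offR)) ⟩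
      word c d′ (map tr S ++ ltr U ∷ R) ∎
      where open ≡-Reasoning
    step-word le (moved p) = move-word le p
    step-word le (idle o)  = word-off c y others _ o

    past* : ∀ S {s R} → All (Off y) (map tr S) → Pull y s [] R → Pull y (map tr S ++ s) S R
    past* []              []       p = p
    past* (node z cs ∷ S) (o ∷ os) p = past o (past* S os p)

    -- The path has to come down again, so the pulled tree can be put back before the next descent.
    unpull : ∀ S Q R {h} → All (Off y) (map tr S) → All (Off y) (map tr Q) → All (Off y) R →
      Dyck (suc h) (word c d′ R) → ∃ λ s → Pull y s S (map tr Q ++ R)
    unpull S Q []            offS offQ offR       ()
    unpull S Q (ltr D ∷ R)   offS offQ offR       dy = _ , past* S offS here
    unpull S Q (ltr U ∷ R)   offS offQ (_ ∷ offR) dy with xs , p ← unpull Q [] R offQ [] offR dy =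
      _ , past* S offS (rise p)
    unpull S Q (tr t ∷ R)    offS offQ (o ∷ offR) dy
      with xs , p ← unpull S (Q ∷ʳ t) R offS (subst (All (Off y)) (sym (map-++ tr Q (t ∷ []))) (All.++⁺ offQ (o ∷ []))) offR
                      (dyck-wordF c d′ (t ∷ []) _ dy) =
      xs , subst (Pull y xs S) (trans (cong (_++ R) (map-++ tr Q (t ∷ []))) (++-assoc (map tr Q) _ R)) p

    count≤-tail : ∀ {t : Tree A} {s} → count y (tr t ∷ s) ≤ 1 → count y s ≤ 1
    count≤-tail {t} = ≤-trans (m≤n+m _ (countF y (t ∷ [])))

    unmove : ∀ s′ {h} → count y s′ ≤ 1 → Dyck h (word c d′ s′) → (∃ λ s → Move y s s′) ⊎ All (Off y) s′
    unmove []            le dy = inj₂ []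
    unmove (ltr U ∷ s′)  le dy with unmove s′ le dy
    ... | inj₁ (_ , p) = inj₁ (_ , skip tt p)
    ... | inj₂ o       = inj₂ (tt ∷ o)
    unmove (ltr D ∷ s′)  {suc h} le dy with unmove s′ le dy
    ... | inj₁ (_ , p) = inj₁ (_ , skip tt p)
    ... | inj₂ o       = inj₂ (tt ∷ o)
    unmove (tr (node z cs) ∷ s′) {h} le dy with z ≟ y
    ... | no z≢y with unmove s′ (count≤-tail {node z cs} {s′} le) (dyck-wordF c d′ (node z cs ∷ []) _ dy)
    ...   | inj₁ (_ , p) = inj₁ (_ , skip z≢y p)
    ...   | inj₂ o       = inj₂ (z≢y ∷ o)
    unmove (tr (node z cs) ∷ s′) {h} le dy | yes refl rewrite below = inj₁ (go h dy)
      where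
      none : countF y cs + 0 + count y s′ ≡ 0
      none = 1+n≤1⇒n≡0 (cong (λ v → v + (countF y cs + 0) + count y s′) (δ-refl y)) le
      -- The opening `D` needs a positive height and the closing `U` brings that height back, so
      -- what follows the valley has to descend, as `unpull` requires.
      go : ∀ h → Dyck h (D ∷ wordF c (c y) cs (U ∷ word c d′ s′)) → ∃ λ s → Move y s (tr (node y cs) ∷ s′)
      go (suc h) dy with _ , p ← unpull cs [] s′ (offF y cs (m+n≡0⇒m≡0 _ (m+n≡0⇒m≡0 (countF y cs + 0) none)))
                                   [] (off y s′ (m+n≡0⇒n≡0 (countF y cs + 0) none))
                                   (dyck-wordF c (c y) cs (U ∷ word c d′ s′) dy) = _ , slide p

    -- At height 0 the first letter of the path cannot be `D`; it is the `U` that the release has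
    -- put there, and the trees `Q` in front of it are what the pull had collected.
    unfree : ∀ Q s′ → All (Off y) (map tr Q) → All (Off y) s′ → 1 ≤ ups s′ → Dyck 0 (word c d′ s′) →
      ∃ λ s → Step y true s (map tr Q ++ s′)
    unfree Q (ltr U ∷ s′) offQ (_ ∷ o) le dy with _ , p ← unpull Q [] s′ offQ [] o dy = _ , freed p
    unfree Q (tr t ∷ s′)  offQ (o ∷ os) le dy
      with s , p ← unfree (Q ∷ʳ t) s′ (subst (All (Off y)) (sym (map-++ tr Q (t ∷ []))) (All.++⁺ offQ (o ∷ []))) os le
                     (dyck-wordF c d′ (t ∷ []) _ dy) =
      s , subst (Step y true s) (trans (cong (_++ s′) (map-++ tr Q (t ∷ []))) (++-assoc (map tr Q) _ s′)) p

    -- To undo a release, `y` must be gone and a `U` must be available. Without a release there is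
    -- no choice: `y` is at a root exactly when it was moved.
    unstep : ∀ b s′ → ⟦ b ⟧ + count y s′ ≤ 1 → ⟦ b ⟧ ≤ ups s′ → Dyck 0 (word c d′ s′) → ∃ λ s → Step y b s s′
    unstep true  s′ (s≤s le) up dy = unfree [] s′ [] (off y s′ (n≤0⇒n≡0 le)) up dy
    unstep false s′ le up dy with unmove s′ le dy
    ... | inj₁ (_ , p) = _ , moved p
    ... | inj₂ o       = _ , idle o

  -- Sweeps

  data Schedule (c : A → A → Bool) (d : A → Bool) : List A → Set where
    done : (∀ z → d z ≡ true) → Schedule c d []
    pass : ∀ {y ys d′} → Passes c y d d′ → Schedule c d′ ys → Schedule c d (y ∷ ys)

  data Sweep (φ : A → Bool) : List A → State A → State A → Set where
    []  : ∀ {s} → Sweep φ [] s s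
    _∷_ : ∀ {y ys s s₁ s′} → Step y (φ y) s s₁ → Sweep φ ys s₁ s′ → Sweep φ (y ∷ ys) s s′

  occurrences : A → List A → ℕ
  occurrences z = sumOver (δ z)

  Complete : List A → Set
  Complete ys = ∀ z → occurrences z ys ≡ 1

  complete-reverse : ∀ {ys} → Complete ys → Complete (reverse ys)
  complete-reverse {ys} co z = trans (sumOver-reverse (δ z) ys) (co z)

  occurs-tail : ∀ {y : A} ys → (∀ z → occurrences z (y ∷ ys) ≤ 1) → ∀ z → occurrences z ys ≤ 1
  occurs-tail {y} ys le z = ≤-trans (m≤n+m _ (δ z y)) (le z)

  fresh : ∀ {y : A} {ys} → (∀ z → occurrences z (y ∷ ys) ≤ 1) → y ∉ ys
  fresh {y} {ys} le y∈ = <⇒≱ (≤-trans (s≤s (occ y∈)) (≤-reflexive (cong (_+ occurrences y ys) (sym (δ-refl y))))) (le y)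
    where
    occ : ∀ {ys} → y ∈ ys → 1 ≤ occurrences y ys
    occ (here refl) = ≤-trans (≤-reflexive (sym (δ-refl y))) (m≤m+n _ _)
    occ (there p)   = ≤-trans (occ p) (m≤n+m _ _)

  sweep-cong : ∀ {φ φ′ ys s s′} → (∀ {y} → y ∈ ys → φ y ≡ φ′ y) → Sweep φ ys s s′ → Sweep φ′ ys s s′
  sweep-cong eq []       = []
  sweep-cong eq (p ∷ ps) = subst (λ b → Step _ b _ _) (eq (here refl)) p ∷ sweep-cong (eq ∘ there) ps

  sweep-total : ∀ ys → (∀ z → occurrences z ys ≤ 1) → ∀ s → ∃₂ λ φ s′ → Sweep φ ys s s′
  sweep-total []       le s = const false , s , []
  sweep-total (y ∷ ys) le s
    with b , s₁ , p ← step-total y s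
    with φ , s′ , ps ← sweep-total ys (occurs-tail ys le) s₁ =
    ψ , s′ , subst (λ v → Step y v s s₁) (sym ψy) p ∷ sweep-cong ψ-tail ps
    where
    -- The value at `y` can be overwritten because `y` does not occur again in `ys`.
    ψ : A → Bool
    ψ z = if does (z ≟ y) then b else φ z
    ψy : ψ y ≡ b
    ψy rewrite dec-true (y ≟ y) refl = refl
    ψ-tail : ∀ {z} → z ∈ ys → φ z ≡ ψ z
    ψ-tail {z} z∈ rewrite dec-false (z ≟ y) (λ { refl → fresh le z∈ }) = refl

  sweep-det : ∀ {φ φ′ ys s s₁ s₂} → Sweep φ ys s s₁ → Sweep φ′ ys s s₂ →
    (∀ {y} → y ∈ ys → φ y ≡ φ′ y) × s₁ ≡ s₂
  sweep-det []       []       = (λ ()) , refl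
  sweep-det {φ} {φ′} (_∷_ {y} {ys} p ps) (q ∷ qs) with eq , refl ← step-det p q with eqs , refl ← sweep-det ps qs =
    agree , refl
    where
    agree : ∀ {z} → z ∈ y ∷ ys → φ z ≡ φ′ z
    agree (here refl) = eq
    agree (there z∈)  = eqs z∈

  sweep-codet : ∀ {φ φ′ ys s₁ s₂ s} → (∀ y → φ y ≡ φ′ y) → Sweep φ ys s₁ s → Sweep φ′ ys s₂ s → s₁ ≡ s₂
  sweep-codet eq []       []       = refl
  sweep-codet eq (p ∷ ps) (q ∷ qs) with refl ← sweep-codet eq ps qs =
    step-codet (subst (λ b → Step _ b _ _) (eq _) p) q refl

  freedAt : (A → Bool) → A → A → ℕ
  freedAt φ z y = if φ y then δ z y else 0

  sweep-count : ∀ z {φ ys s s′} → Sweep φ ys s s′ → count z s ≡ sumOver (freedAt φ z) ys + count z s′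
  sweep-count z []       = refl
  sweep-count z {φ} (_∷_ {y} {ys} p ps) =
    trans (step-count z p) (trans (cong (freedAt φ z y +_) (sweep-count z ps)) (sym (+-assoc (freedAt φ z y) _ _)))

  freed-total : ∀ φ z ys → sumOver (freedAt φ z) ys ≡ (if φ z then occurrences z ys else 0)
  freed-total φ z []       with φ z
  ... | true  = refl
  ... | false = refl
  freed-total φ z (y ∷ ys) rewrite freed-total φ z ys with z ≟ y
  ... | yes refl with φ z
  ...   | true  = refl
  ...   | false = refl
  freed-total φ z (y ∷ ys) | no _ with φ y | φ z
  ...   | true  | true  = refl
  ...   | true  | false = refl
  ...   | false | true  = refl
  ...   | false | false = refl

  cardinality : (A → Bool) → List A → ℕ
  cardinality φ = sumOver (λ y → ⟦ φ y ⟧)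

  sweep-ups : ∀ {φ ys s s′} → Sweep φ ys s s′ → ups s′ ≡ cardinality φ ys + ups s
  sweep-ups []       = refl
  sweep-ups {φ} {s = s} (_∷_ {y} {ys} p ps) rewrite sweep-ups ps | step-ups p =
    solve 3 (λ a b u → b :+ (a :+ u) := a :+ b :+ u) refl ⟦ φ y ⟧ (cardinality φ ys) (ups s)

  sweep-word : ∀ {c d φ ys s s′} → Schedule c d ys → (∀ z → count z s ≤ 1) →
    Sweep φ ys s s′ → word c d s ≡ word c (const true) s′
  sweep-word {c} {s = s} (done all) le [] = word-cong c all s
  sweep-word (pass ps sch) le (p ∷ qs) =
    trans (step-word ps (le _) p)
      (sweep-word sch (λ z → ≤-trans (≤-trans (m≤n+m _ _) (≤-reflexive (sym (step-count z p)))) (le z)) qs)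

  -- The steps are undone last first. Each undone release costs one `U`, and the final path has at
  -- least as many of them as there are releases, so one is left whenever it is needed. The height
  -- condition is carried back by `sweep-word`.
  unsweep : ∀ {c d φ} ys {s′} → Schedule c d ys → (∀ z → sumOver (freedAt φ z) ys + count z s′ ≤ 1) →
    cardinality φ ys ≤ ups s′ → Dyck 0 (word c (const true) s′) → ∃ λ s → Sweep φ ys s s′
  unsweep [] sch le up dy = _ , []
  unsweep {c} {d} {φ} (y ∷ ys) {s′} (pass {d′ = d′} ps sch) le up dy
    = let s₁ , qs = unsweep ys sch
                      (λ z → ≤-trans (+-monoˡ-≤ (count z s′) (m≤n+m _ (freedAt φ z y))) (le z))
                      (≤-trans (m≤n+m _ ⟦ φ y ⟧) up) dy
          s , p   = last-step s₁ qs
      in s , p ∷ qs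
    where
    last-step : ∀ s₁ → Sweep φ ys s₁ s′ → ∃ λ s → Step y (φ y) s s₁
    last-step s₁ qs = unstep ps (φ y) s₁ (subst (λ v → v + count y s₁ ≤ 1) (freedAt-self (φ y)) (bound y))
        up₁ (subst (Dyck 0) (sym (sweep-word sch (λ z → ≤-trans (m≤n+m _ (freedAt φ z y)) (bound z)) qs)) dy)
      where
      bound : ∀ z → freedAt φ z y + count z s₁ ≤ 1
      bound z rewrite sweep-count z qs
        | sym (+-assoc (freedAt φ z y) (sumOver (freedAt φ z) ys) (count z s′)) = le z
      freedAt-self : ∀ b → (if b then δ y y else 0) ≡ ⟦ b ⟧
      freedAt-self true  = δ-refl y
      freedAt-self false = refl
      up₁ : ⟦ φ y ⟧ ≤ ups s₁
      up₁ = +-cancelˡ-≤ (cardinality φ ys) _ _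
        (≤-trans (≤-reflexive (+-comm (cardinality φ ys) _)) (≤-trans up (≤-reflexive (sweep-ups qs))))

  schedule-cong : ∀ {c d d′ ys} → (∀ z → d z ≡ d′ z) → Schedule c d ys → Schedule c d′ ys
  schedule-cong eq (done all) = done (λ z → trans (sym (eq z)) (all z))
  schedule-cong eq (pass ps sch) = pass (record
    { threshold = λ z z≢y → trans (sym (eq z)) (threshold z z≢y)
    ; above     = trans (sym (eq _)) above
    ; others    = λ z z≢y → trans (sym (eq z)) (others z z≢y)
    ; below     = below }) sch
    where open Passes ps

  -- In the opposite direction the labels ahead are those that had been passed, whence the negation,
  -- and before and after change places. The condition `threshold` survives since `d` and `d′` agree
  -- away from `y`.
  schedule-ʳ++ : ∀ {c d ys acc} → Schedule c d ys → Schedule (λ y z → not (c y z)) (not ∘ d) acc →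
    Schedule (λ y z → not (c y z)) (const false) (ys ʳ++ acc)
  schedule-ʳ++ (done all) back = schedule-cong (λ z → cong not (all z)) back
  schedule-ʳ++ (pass ps sch) back = schedule-ʳ++ sch (pass (record
    { threshold = λ z z≢y → cong not (trans (sym (others z z≢y)) (threshold z z≢y))
    ; above     = cong not below
    ; others    = λ z z≢y → cong not (sym (others z z≢y))
    ; below     = cong not above }) back)
    where open Passes ps

  schedule-reverse : ∀ {c ys} → Schedule c (const false) ys →
    Schedule (λ y z → not (c y z)) (const false) (reverse ys)
  schedule-reverse sch = schedule-ʳ++ sch (done (λ _ → refl))

-- The words ε_m

stagesWord : ∀ {J : Set} → List (ℕ × J) → List Letter
stagesWord []             = []
stagesWord ((n , _) ∷ js) = replicate n U ++ (map op (stagesWord js) ++ replicate n D)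

Descending : ∀ {J : Set} → ℕ → List (ℕ × J) → Set
Descending b []             = ⊤
Descending b ((n , _) ∷ js) = n ≤ b × Descending n js

dyck-ups : ∀ n {h k} → Dyck (n + h) k → Dyck h (replicate n U ++ k)
dyck-ups zero    dy = dy
dyck-ups (suc n) {h} {k} dy = dyck-ups n (subst (λ v → Dyck v k) (sym (+-suc n h)) dy)

dyck-downs : ∀ n {h k} → Dyck h k → Dyck (n + h) (replicate n D ++ k)
dyck-downs zero    dy = dy
dyck-downs (suc n) dy = dyck-downs n dy

map-op-involutive : ∀ w → map op (map op w) ≡ w
map-op-involutive []      = refl
map-op-involutive (a ∷ w) = cong₂ _∷_ (op-involutive a) (map-op-involutive w)

mutual
  dyck-stages : ∀ {J : Set} (js : List (ℕ × J)) {b h k} → Descending b js → Dyck h k →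
    Dyck h (stagesWord js ++ k)
  dyck-stages []             ds dy = dy
  dyck-stages ((n , _) ∷ js) {h = h} {k} (_ , ds) dy
    rewrite ++-assoc (replicate n U) (map op (stagesWord js) ++ replicate n D) k
          | ++-assoc (map op (stagesWord js)) (replicate n D) k =
    dyck-ups n (dyck-op-stages js ds (m≤m+n n h) (dyck-downs n dy))

  -- The opposite word begins with a descent. Its length is at most that of the enclosing ascent
  -- because block lengths decrease inwards; this is what the bound `b ≤ h` carries along.
  dyck-op-stages : ∀ {J : Set} (js : List (ℕ × J)) {b h k} → Descending b js → b ≤ h → Dyck h k →
    Dyck h (map op (stagesWord js) ++ k)
  dyck-op-stages []             ds le dy = dy
  dyck-op-stages ((n , _) ∷ js) {h = h} {k} (n≤b , ds) b≤h dy
    with h′ , refl ← m≤n⇒∃[o]m+o≡n (≤-trans n≤b b≤h)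
    rewrite map-++ op (replicate n U) (map op (stagesWord js) ++ replicate n D)
          | map-++ op (map op (stagesWord js)) (replicate n D)
          | map-op-involutive (stagesWord js)
          | map-replicate op n U | map-replicate op n D
          | ++-assoc (replicate n D) (stagesWord js ++ replicate n U) k
          | ++-assoc (stagesWord js) (replicate n U) k =
    dyck-downs n (dyck-stages js ds (dyck-ups n dy))

stages-dyck : ∀ {J : Set} (js : List (ℕ × J)) {b} → Descending b js → Dyck 0 (stagesWord js)
stages-dyck js ds = subst (Dyck 0) (++-identityʳ (stagesWord js)) (dyck-stages js {h = 0} {[]} ds refl)

-- Stripping the outermost block

word-++ : ∀ {A : Set} (c : A → A → Bool) d s s′ → word c d (s ++ s′) ≡ word c d s ++ word c d s′
word-++ c d []          s′ = refl
word-++ c d (ltr a ∷ s) s′ = cong (a ∷_) (word-++ c d s s′)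
word-++ c d (tr t ∷ s)  s′ rewrite word-++ c d s s′ = wordF-++ c d (t ∷ []) (word c d s) (word c d s′)

word-replicate : ∀ {A : Set} (c : A → A → Bool) d n a → word c d (replicate n (ltr a)) ≡ replicate n a
word-replicate c d zero    a = refl
word-replicate c d (suc n) a = cong (a ∷_) (word-replicate c d n a)

-- When the extra vertex is above all labels every hanging tree starts with `D`, so a leading `U` is
-- a letter of the path.
strip-ups : ∀ {A : Set} (c : A → A → Bool) n s {v} → word c (const true) s ≡ replicate n U ++ v →
  ∃ λ s′ → s ≡ replicate n (ltr U) ++ s′ × word c (const true) s′ ≡ v
strip-ups c zero    s eq = s , refl , eq
strip-ups c (suc n) (ltr a ∷ s) eq
  with refl , eq′ ← ∷-injective eq
  with s′ , refl , eq″ ← strip-ups c n s eq′ = s′ , refl , eq″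
strip-ups c (suc n) (tr (node _ _) ∷ s) ()

-- Likewise every hanging tree ends with `U`, so a final `D` is a letter of the path.
strip-last : ∀ {A : Set} (c : A → A → Bool) s {v} → word c (const true) s ≡ v ∷ʳ D →
  ∃ λ s′ → s ≡ s′ ∷ʳ ltr D × word c (const true) s′ ≡ v
strip-last c s {v} eq with initLast s
... | [] = contradiction (sym eq) (++-∷-≢[] v)
  where
  ++-∷-≢[] : ∀ v → v ∷ʳ D ≢ []
  ++-∷-≢[] []      ()
  ++-∷-≢[] (_ ∷ _) ()
... | s′ ∷ʳ′ ltr a
  with refl , refl ← ∷ʳ-injective _ v (trans (sym (word-++ c (const true) s′ _)) eq) = s′ , refl , refl
... | s′ ∷ʳ′ tr (node y cs) =
  contradiction (∷ʳ-injectiveʳ (word c (const true) s′ ++ D ∷ wordF c (c y) cs []) v (begin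
    (word c (const true) s′ ++ D ∷ wordF c (c y) cs []) ∷ʳ U  ≡⟨ ++-assoc (word c (const true) s′) _ _ ⟩
    word c (const true) s′ ++ D ∷ wordF c (c y) cs [] ∷ʳ U    ≡⟨ cong (λ w → word c (const true) s′ ++ D ∷ w) (wordF-++ c (c y) cs [] (U ∷ [])) ⟨
    word c (const true) s′ ++ D ∷ wordF c (c y) cs (U ∷ [])   ≡⟨ word-++ c (const true) s′ _ ⟨
    word c (const true) (s′ ∷ʳ tr (node y cs))                ≡⟨ eq ⟩
    v ∷ʳ D                                                    ∎)) λ ()
  where open ≡-Reasoning

strip-downs : ∀ {A : Set} (c : A → A → Bool) n s {v} → word c (const true) s ≡ v ++ replicate n D →
  ∃ λ s′ → s ≡ s′ ++ replicate n (ltr D) × word c (const true) s′ ≡ v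
strip-downs c zero    s {v} eq = s , sym (++-identityʳ s) , trans eq (++-identityʳ v)
strip-downs c (suc n) s {v} eq
  with s₁ , refl , eq₁ ← strip-downs c n s {v ∷ʳ D} (trans eq (sym (++-assoc v (D ∷ []) (replicate n D))))
  with s₂ , refl , eq₂ ← strip-last c s₁ eq₁ = s₂ , ++-assoc s₂ (ltr D ∷ []) (replicate n (ltr D)) , eq₂

-- Stages: sweeps in alternating directions, with a block stripped after each.

module _ {L m : ℕ} where

  wrap : ℕ → State (Fin L) → State (Fin L)
  wrap n s = replicate n (ltr U) ++ (map opItem s ++ replicate n (ltr D))

  wrap-injective : ∀ n {s s′} → wrap n s ≡ wrap n s′ → s ≡ s′
  wrap-injective n eq = map-injective opItem-injective
    (++-cancelʳ (replicate n (ltr D)) _ _ (++-cancelˡ (replicate n (ltr U)) _ _ eq))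
    where
    opItem-injective : ∀ {i j : Item (Fin L)} → opItem i ≡ opItem j → i ≡ j
    opItem-injective {i} {j} e = trans (sym (opItem-involutive i)) (trans (cong opItem e) (opItem-involutive j))

  word-wrap : ∀ c n s → word c (const true) (wrap n s) ≡
    replicate n U ++ (map op (word (λ y z → not (c y z)) (const false) s) ++ replicate n D)
  word-wrap c n s
    rewrite word-++ c (const true) (replicate n (ltr U)) (map opItem s ++ replicate n (ltr D))
          | word-++ c (const true) (map opItem s) (replicate n (ltr D))
          | word-replicate c (const true) n U | word-replicate c (const true) n D
          | word-op c (const true) s = refl

  count-letters : ∀ z n a → count {L} z (replicate n (ltr a)) ≡ 0
  count-letters z zero    a = refl
  count-letters z (suc n) a = count-letters z n a

  count-wrap : ∀ z n s → count z (wrap n s) ≡ count z s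
  count-wrap z n s
    rewrite count-++ z (replicate n (ltr U)) (map opItem s ++ replicate n (ltr D))
          | count-++ z (map opItem s) (replicate n (ltr D))
          | count-letters z n U | count-letters z n D | count-op z s = +-identityʳ _

  ups-replicate-U : ∀ n → ups {Fin L} (replicate n (ltr U)) ≡ n
  ups-replicate-U zero    = refl
  ups-replicate-U (suc n) = cong suc (ups-replicate-U n)

  ups-replicate-D : ∀ n → ups {Fin L} (replicate n (ltr D)) ≡ 0
  ups-replicate-D zero    = refl
  ups-replicate-D (suc n) = ups-replicate-D n

  ups-wrap : ∀ n s → ups (wrap n s) ≡ n + downs s
  ups-wrap n s
    rewrite ups-++ (replicate n (ltr U)) (map opItem s ++ replicate n (ltr D))
          | ups-++ (map opItem s) (replicate n (ltr D))
          | ups-op s | ups-replicate-U n | ups-replicate-D n | +-identityʳ (downs s) = refl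

  -- The opposite reading of `const true` is `const false`: for the remainder, the extra vertex is
  -- again in front of all labels, and the next sweep can start.
  unwrap : ∀ c n s w → word c (const true) s ≡ replicate n U ++ (map op w ++ replicate n D) →
    ∃ λ s′ → s ≡ wrap n s′ × word (λ y z → not (c y z)) (const false) s′ ≡ w
  unwrap c n s w eq
    with s₁ , refl , eq₁ ← strip-ups c n s eq
    with s₂ , refl , eq₂ ← strip-downs c n s₁ {map op w} eq₁ =
      map opItem s₂ , cong (λ v → replicate n (ltr U) ++ (v ++ replicate n (ltr D))) (sym s₂≡)
      , (begin
          word c̄ (const false) (map opItem s₂)          ≡⟨ map-op-involutive _ ⟨
          map op (map op (word c̄ (const false) (map opItem s₂)))
            ≡⟨ cong (map op) (word-op c (const true) (map opItem s₂)) ⟨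
          map op (word c (const true) (map opItem (map opItem s₂))) ≡⟨ cong (map op ∘ word c (const true)) s₂≡ ⟩
          map op (word c (const true) s₂)               ≡⟨ cong (map op) eq₂ ⟩
          map op (map op w)                             ≡⟨ map-op-involutive w ⟩
          w                                             ∎)
      where
      open ≡-Reasoning
      c̄ : Fin L → Fin L → Bool
      c̄ y z = not (c y z)
      s₂≡ : map opItem (map opItem s₂) ≡ s₂
      s₂≡ = trans (sym (map-∘ s₂)) (trans (map-cong opItem-involutive s₂) (map-id s₂))

  Stages : Set
  Stages = List (ℕ × Fin m)

  -- A run has to end in the empty state. With the counts of `run-count`, this forces each label to
  -- be released as often as it occurs at the start.
  data Run (φ : Fin m → Fin L → Bool) (ys : List (Fin L)) : Stages → State (Fin L) → Set where
    []    : Run φ ys [] []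
    stage : ∀ {n j js s s′} → Sweep (φ j) ys s (wrap n s′) → Run φ (reverse ys) js s′ →
            Run φ ys ((n , j) ∷ js) s

  run-cong : ∀ {φ φ′ ys js s} → (∀ {j} → j ∈ map proj₂ js → ∀ y → φ j y ≡ φ′ j y) →
    Run φ ys js s → Run φ′ ys js s
  run-cong eq []           = []
  run-cong eq (stage sw r) = stage (sweep-cong (λ _ → eq (here refl) _) sw) (run-cong (eq ∘ there) r)

  run-total : ∀ {c ys} js {s} → Schedule c (const false) ys → Complete ys → Unique (map proj₂ js) →
    (∀ z → count z s ≤ 1) → word c (const false) s ≡ stagesWord js → ∃ λ φ → Run φ ys js s
  run-total [] {[]}                  sch co un le eq = (λ _ _ → false) , []
  run-total [] {tr (node _ _) ∷ s}   sch co un le ()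
  run-total {c} {ys} ((n , j) ∷ js) {s} sch co (j∉ ∷ un) le eq
    with φ₀ , s₁ , sw ← sweep-total ys (≤-reflexive ∘ co) s
    with s′ , refl , eq′ ← unwrap c n s₁ (stagesWord js) (trans (sym (sweep-word sch le sw)) eq)
    with φ , r ← run-total js {s′} (schedule-reverse sch) (complete-reverse {ys = ys} co) un
                   (λ z → ≤-trans (≤-trans (≤-reflexive (sym (count-wrap z n s′)))
                     (≤-trans (m≤n+m _ _) (≤-reflexive (sym (sweep-count z sw))))) (le z)) eq′ =
    ψ , stage (sweep-cong (λ _ → cong-app (sym ψj) _) sw) (run-cong (λ i∈ y → cong-app (sym (ψ-others (lookup-≢ j∉ i∈))) y) r)
    where
    ψ : Fin m → Fin L → Bool
    ψ i = if does (j ≟ i) then φ₀ else φ i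
    ψj : ψ j ≡ φ₀
    ψj rewrite dec-true (j ≟ j) refl = refl
    ψ-others : ∀ {i} → j ≢ i → ψ i ≡ φ i
    ψ-others {i} j≢i rewrite dec-false (j ≟ i) j≢i = refl
    lookup-≢ : ∀ {is i} → All (j ≢_) is → i ∈ is → j ≢ i
    lookup-≢ (q ∷ _) (here refl) = q
    lookup-≢ (_ ∷ q) (there i∈)  = lookup-≢ q i∈

  run-det : ∀ {φ φ′ ys js s} → Run φ ys js s → Run φ′ ys js s →
    ∀ {j} → j ∈ map proj₂ js → ∀ {y} → y ∈ ys → φ j y ≡ φ′ j y
  run-det (stage {n} sw r) (stage sw′ r′) j∈ y∈ with eqs , eq ← sweep-det sw sw′
    with refl ← wrap-injective n eq with j∈
  ... | here refl = eqs y∈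
  ... | there j∈′ = run-det r r′ j∈′ (reverse⁺ y∈)

  run-codet : ∀ {φ φ′ ys js s s′} → (∀ j y → φ j y ≡ φ′ j y) → Run φ ys js s → Run φ′ ys js s′ → s ≡ s′
  run-codet eq []           []             = refl
  run-codet eq (stage sw r) (stage sw′ r′) with refl ← run-codet eq r r′ = sweep-codet (eq _) sw sw′

  stage-count : ∀ {φ ys n s s′} → Complete ys → Sweep φ ys s (wrap n s′) → ∀ z → count z s ≡ ⟦ φ z ⟧ + count z s′
  stage-count {φ} {ys} {n} {s} {s′} co sw z
    rewrite sweep-count z sw | freed-total φ z ys | co z | count-wrap z n s′ = refl

  run-count : ∀ {φ ys js s} → Complete ys → Run φ ys js s → ∀ z → count z s ≡ sumOver (λ j → ⟦ φ (proj₂ j) z ⟧) js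
  run-count co [] z = refl
  run-count {φ} {ys} co (stage {n} {j} {s′ = s′} sw r) z = trans (stage-count {n = n} {s′ = s′} co sw z)
    (cong (⟦ φ j z ⟧ +_) (run-count (complete-reverse {ys = ys} co) r z))

  -- u is the number of ascents left unglued before the stages of the list.
  Budget : (Fin m → ℕ) → ℕ → Stages → Set
  Budget b u []             = u ≡ 0
  Budget b u ((n , j) ∷ js) = ∃ λ u′ → b j + u ≡ n + u′ × Budget b u′ js

  run-budget : ∀ {φ c ys js s b₀} b → (∀ j → cardinality (φ j) ys ≡ b j) → Schedule c (const false) ys →
    (∀ z → count z s ≤ 1) → word c (const false) s ≡ stagesWord js → Descending b₀ js →
    Run φ ys js s → Budget b (ups s) js
  run-budget b card sch le eq ds [] = refl
  run-budget {φ} {c} {ys} {(n , j) ∷ js} b card sch le eq (_ , ds) (stage {s = s} {s′} sw r)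
    -- The state is already wrapped; `unwrap` serves to obtain the word of `s′`, which injectivity
    -- of `wrap` identifies with `s″`.
    with s″ , eq₁ , eq₂ ← unwrap c n (wrap n s′) (stagesWord js) (trans (sym (sweep-word sch le sw)) eq)
    with refl ← wrap-injective n eq₁ =
    ups s′ , (begin
      b j + ups s                  ≡⟨ cong (_+ ups s) (card j) ⟨
      cardinality (φ j) ys + ups s ≡⟨ sweep-ups sw ⟨
      ups (wrap n s′)              ≡⟨ ups-wrap n s′ ⟩
      n + downs s′                 ≡⟨ cong (n +_) (dyck-balanced _ _ s′ (subst (Dyck 0) (sym eq₂) (stages-dyck js ds))) ⟨
      n + ups s′                   ∎)
    , run-budget b (λ j → trans (sumOver-reverse _ ys) (card j)) (schedule-reverse sch)
        (λ z → ≤-trans (≤-trans (≤-reflexive (sym (count-wrap z n s′)))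
                     (≤-trans (m≤n+m _ _) (≤-reflexive (sym (sweep-count z sw))))) (le z)) eq₂ ds r
    where open ≡-Reasoning

  -- Built backwards from the empty state: the inner stages are undone, the block is put back, and
  -- the sweep is undone. The budget gives `b j ≤ n + u′`, which is the number of `U` available for
  -- the sweep.
  run-exists : ∀ {φ c ys} js {b₀ u} b → (∀ j → cardinality (φ j) ys ≡ b j) → Schedule c (const false) ys →
    Complete ys → (∀ z → sumOver (λ j → ⟦ φ (proj₂ j) z ⟧) js ≤ 1) → Descending b₀ js → Budget b u js →
    ∃ λ s → Run φ ys js s × ups s ≡ u × word c (const false) s ≡ stagesWord js
  run-exists [] b card sch co le ds refl = [] , [] , refl , refl
  run-exists {φ} {c} {ys} ((n , j) ∷ js) {u = u} b card sch co le (n≤b , ds) (u′ , bal , bd)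
    with s′ , r , up , eq ← run-exists {φ} {_} {reverse ys} js b (λ j → trans (sumOver-reverse _ ys) (card j))
                              (schedule-reverse sch) (complete-reverse {ys = ys} co)
                              (λ z → ≤-trans (m≤n+m _ _) (le z)) ds bd
    = let s , sw = last in
      s , stage sw r
      , +-cancelˡ-≡ (b j) _ _ (begin
          b j + ups s                  ≡⟨ cong (_+ ups s) (card j) ⟨
          cardinality (φ j) ys + ups s ≡⟨ sweep-ups sw ⟨
          ups (wrap n s′)              ≡⟨ ups₁ ⟩
          n + u′                       ≡⟨ bal ⟨
          b j + u                      ∎)
      , trans (sweep-word sch (λ z → subst (_≤ 1) (sym (run-count co (stage {n = n} {s′ = s′} sw r) z)) (le z)) sw) word₁
    where
    open ≡-Reasoning
    word₁ : word c (const true) (wrap n s′) ≡ stagesWord ((n , j) ∷ js)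
    word₁ rewrite word-wrap c n s′ | eq = refl
    ups₁ : ups (wrap n s′) ≡ n + u′
    ups₁ = trans (ups-wrap n s′) (cong (n +_) (trans
      (sym (dyck-balanced _ _ s′ (subst (Dyck 0) (sym eq) (stages-dyck js ds)))) up))
    bound : ∀ z → sumOver (freedAt (φ j) z) ys + count z (wrap n s′) ≤ 1
    bound z rewrite freed-total (φ j) z ys | co z | count-wrap z n s′
      | run-count (complete-reverse {ys = ys} co) r z = le z
    last : ∃ λ s → Sweep (φ j) ys s (wrap n s′)
    last = unsweep ys sch bound
      (≤-trans (≤-reflexive (card j)) (≤-trans (m≤m+n (b j) u) (≤-reflexive (trans bal (sym ups₁)))))
      (subst (Dyck 0) (sym word₁) (stages-dyck ((n , j) ∷ js) (n≤b , ds)))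

-- Plane trees as non-crossing matchings of the edges of a polygon.

labels : ∀ {A : Set} → Forest A → List A
labels []               = []
labels (node y cs ∷ ts) = y ∷ labels cs ++ labels ts

relabel : ∀ {A B : Set} → (A → B) → Forest A → Forest B
relabel f []               = []
relabel f (node y cs ∷ ts) = node (f y) (relabel f cs) ∷ relabel f ts

labels-relabel : ∀ {A B : Set} (f : A → B) F → labels (relabel f F) ≡ map f (labels F)
labels-relabel f []               = refl
labels-relabel f (node y cs ∷ ts) = cong (f y ∷_)
  (trans (cong₂ _++_ (labels-relabel f cs) (labels-relabel f ts)) (sym (map-++ f (labels cs) (labels ts))))

-- Corners are numbered as in the polygon: edge p joins the corners p and suc p.  The forest hangs
-- below a vertex labelled x and is traversed from corner i to corner k.
data Contour {A : Set} (σ : ℕ → ℕ) (ℓ : ℕ → A) (x : A) : ℕ → Forest A → ℕ → Set where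
  []   : ∀ {i} → Contour σ ℓ x i [] i
  edge : ∀ {i j k y cs ts} → σ i ≡ j → σ j ≡ i → ℓ (suc i) ≡ y → ℓ (suc j) ≡ x →
         Contour σ ℓ y (suc i) cs j → Contour σ ℓ x (suc j) ts k → Contour σ ℓ x i (node y cs ∷ ts) k

data Region (i j k p : ℕ) : Set where
  first  : p ≡ i → Region i j k p
  inside : suc i ≤ p → p < j → Region i j k p
  last   : p ≡ j → Region i j k p
  after  : suc j ≤ p → p < k → Region i j k p

region : ∀ {i} j {k p} → i ≤ p → p < k → Region i j k p
region {i} j {k} {p} i≤p p<k with m≤n⇒m<n∨m≡n i≤p
... | inj₂ refl = first refl
... | inj₁ i<p with <-cmp p j
...   | tri< p<j _ _ = inside i<p p<j
...   | tri≈ _ p≡j _ = last p≡j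
...   | tri> _ _ j<p = after j<p p<k

module _ {A : Set} {σ : ℕ → ℕ} {ℓ : ℕ → A} where

  contour-≤ : ∀ {x i F k} → Contour σ ℓ x i F k → i ≤ k
  contour-≤ []                 = ≤-refl
  contour-≤ (edge _ _ _ _ p q) = ≤-trans (n≤1+n _) (≤-trans (contour-≤ p) (≤-trans (n≤1+n _) (contour-≤ q)))

  contour-end : ∀ {x i F k} → ℓ i ≡ x → Contour σ ℓ x i F k → ℓ k ≡ x
  contour-end ℓi []                  = ℓi
  contour-end ℓi (edge _ _ _ ℓj _ q) = contour-end ℓj q

  record Matched (i k p : ℕ) : Set where
    field
      lower      : i ≤ σ p
      upper      : σ p < k
      involutive : σ (σ p) ≡ p
      fixfree    : σ p ≢ p
  open Matched

  contour-matched : ∀ {x i F k} → Contour σ ℓ x i F k → ∀ p → i ≤ p → p < k → Matched i k p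
  contour-matched [] p i≤p p<i = contradiction i≤p (<⇒≱ p<i)
  contour-matched {i = i} {k = k} (edge {j = j} refl σj ℓi ℓj cs ts) p i≤p p<k = go (region j i≤p p<k)
    where
    i<j = contour-≤ cs
    j<k = contour-≤ ts
    go : Region i j k p → Matched i k p
    go (first refl) = record { lower = <⇒≤ i<j ; upper = j<k ; involutive = σj ; fixfree = >⇒≢ i<j }
    go (last refl)  = record
      { lower = ≤-reflexive (sym σj) ; upper = subst (_< k) (sym σj) (<-trans i<j j<k)
      ; involutive = cong σ σj ; fixfree = λ eq → <⇒≢ i<j (trans (sym σj) eq) }
    go (inside l u) with m ← contour-matched cs p l u = record
      { lower = <⇒≤ (lower m) ; upper = <-trans (upper m) j<k
      ; involutive = involutive m ; fixfree = fixfree m }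
    go (after l u) with m ← contour-matched ts p l u = record
      { lower = ≤-trans (<⇒≤ i<j) (<⇒≤ (lower m)) ; upper = upper m
      ; involutive = involutive m ; fixfree = fixfree m }

  contour-noncrossing : ∀ {x i F k} → Contour σ ℓ x i F k → ∀ {p q} → i ≤ p → p < q → q < σ p → σ p < σ q →
    σ q < k → ⊥
  contour-noncrossing [] i≤p p<q q<r r<s s<k = <⇒≱ (<-trans p<q (<-trans q<r (<-trans r<s s<k))) i≤p
  contour-noncrossing {i = i} {k = k} (edge {j = j} σi σj ℓi ℓj cs ts) {p} {q} i≤p p<q q<r r<s s<k =
    go (region j i≤p (<-trans p<q (<-trans q<r (<-trans r<s s<k))))
    where
    go : Region i j k p → ⊥
    go (first refl) = <⇒≱ (upper (contour-matched cs q p<q (subst (q <_) σi q<r)))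
                          (<⇒≤ (subst (_< σ q) σi r<s))
    go (last refl)  = <⇒≱ (<-trans p<q q<r) (≤-trans (≤-reflexive σj) i≤p)
    go (after l u)  = contour-noncrossing ts l p<q q<r r<s s<k
    go (inside l u) = contour-noncrossing cs l p<q q<r r<s (upper (contour-matched cs q
      (≤-trans l (<⇒≤ p<q)) (<-trans q<r (upper (contour-matched cs p l u)))))

  -- The corner before an edge and the corner after its partner lie at the same end of the tree
  -- edge: at the parent if the edge opens a child, at the child if it closes it.
  contour-glue : ∀ {x i F k} → ℓ i ≡ x → Contour σ ℓ x i F k → ∀ p → i ≤ p → p < k → ℓ p ≡ ℓ (suc (σ p))
  contour-glue ℓx [] p i≤p p<i = contradiction i≤p (<⇒≱ p<i)
  contour-glue {x} {i} {k = k} ℓx (edge {j = j} refl σj refl ℓj cs ts) p i≤p p<k = go (region j i≤p p<k)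
    where
    go : Region i j k p → ℓ p ≡ ℓ (suc (σ p))
    go (first refl) = trans ℓx (sym ℓj)
    go (last refl)  = trans (contour-end refl cs) (cong (ℓ ∘ suc) (sym σj))
    go (inside l u) = contour-glue refl cs p l u
    go (after l u)  = contour-glue ℓj ts p l u

  contour-label : ∀ {x i F k} → ℓ i ≡ x → Contour σ ℓ x i F k → ∀ p → i ≤ p → p ≤ k → ℓ p ∈ x ∷ labels F
  contour-label ℓx [] p i≤p p≤i with refl ← ≤-antisym i≤p p≤i = here ℓx
  contour-label ℓx (edge {j = j} {cs = cs} _ _ ℓi ℓj c t) p i≤p p≤k with m≤n⇒m<n∨m≡n i≤p
  ... | inj₂ refl = here ℓx
  ... | inj₁ i<p with p ≤? j
  ...   | yes p≤j = there (∈-++⁺ˡ (contour-label ℓi c p i<p p≤j))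
  ...   | no p≰j with contour-label ℓj t p (≰⇒> p≰j) p≤k
  ...     | here eq  = here eq
  ...     | there z∈ = there (there (∈-++⁺ʳ (labels cs) z∈))

  contour-∈ : ∀ {x i F k z} → Contour σ ℓ x i F k → z ∈ labels F → ∃ λ p → i < p × p ≤ k × ℓ p ≡ z
  contour-∈ (edge _ _ ℓi _ c t) (here refl) =
    _ , ≤-refl , ≤-trans (contour-≤ c) (≤-trans (n≤1+n _) (contour-≤ t)) , ℓi
  contour-∈ (edge {cs = cs} _ _ _ _ c t) (there z∈) with ∈-++⁻ (labels cs) z∈
  ... | inj₁ z∈c with p , l , u , eq ← contour-∈ c z∈c =
    p , <⇒≤ l , ≤-trans u (≤-trans (n≤1+n _) (contour-≤ t)) , eq
  ... | inj₂ z∈t with p , l , u , eq ← contour-∈ t z∈t =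
    p , ≤-trans (s≤s (≤-trans (n≤1+n _) (contour-≤ c))) (<⇒≤ l) , u , eq

  unique-disjoint : ∀ {x y : A} xs ys → Unique (x ∷ y ∷ xs ++ ys) →
    Unique (y ∷ xs) × Unique (x ∷ ys) × (∀ {z} → z ∈ y ∷ xs → z ∈ x ∷ ys → ⊥)
  unique-disjoint {x} {y} xs ys ((x≢y ∷ x∉) ∷ (y∉ ∷ u)) =
    All.++⁻ˡ xs y∉ ∷ uniqueˡ xs u , All.++⁻ʳ xs x∉ ∷ uniqueʳ xs u , disjoint
    where
    uniqueˡ : ∀ xs → Unique (xs ++ ys) → Unique xs
    uniqueˡ []       u       = []
    uniqueˡ (x ∷ xs) (p ∷ u) = All.++⁻ˡ xs p ∷ uniqueˡ xs u
    uniqueʳ : ∀ xs → Unique (xs ++ ys) → Unique ys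
    uniqueʳ []       u       = u
    uniqueʳ (x ∷ xs) (p ∷ u) = uniqueʳ xs u
    apart : ∀ {z} xs → Unique (xs ++ ys) → z ∈ xs → z ∈ ys → ⊥
    apart (_ ∷ xs) (p ∷ u) (here refl) z∈ys = All.lookup (All.++⁻ʳ xs p) z∈ys refl
    apart (_ ∷ xs) (p ∷ u) (there z∈)  z∈ys = apart xs u z∈ z∈ys
    disjoint : ∀ {z} → z ∈ y ∷ xs → z ∈ x ∷ ys → ⊥
    disjoint (here refl) (here refl) = x≢y refl
    disjoint (here refl) (there z∈)  = All.lookup (All.++⁻ʳ xs y∉) z∈ refl
    disjoint (there z∈)  (here refl) = All.lookup (All.++⁻ˡ xs x∉) z∈ refl
    disjoint (there z∈)  (there z∈′) = apart xs u z∈ z∈′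

  module Identify (_≈_ : ℕ → ℕ → Set) (≈-refl : ∀ {p} → p ≈ p) (≈-sym : ∀ {p q} → p ≈ q → q ≈ p)
      (≈-trans : ∀ {p q r} → p ≈ q → q ≈ r → p ≈ r) {N : ℕ} (glued : ∀ p → p < N → p ≈ suc (σ p)) where

    -- The converse of `contour-glue`: corners with equal labels are glued. The starting corner `i`
    -- is exchanged for `suc j` through the first edge; the remaining corners fall into the child's
    -- interval and the siblings' interval, and uniqueness of labels rules out a coincidence between
    -- the two.
    contour-≈ : ∀ {x i F k} → Contour σ ℓ x i F k → ℓ i ≡ x → Unique (x ∷ labels F) → k ≤ N →
      ∀ p q → i ≤ p → p ≤ k → i ≤ q → q ≤ k → ℓ p ≡ ℓ q → p ≈ q
    contour-≈ [] ℓx u k≤N p q l₁ u₁ l₂ u₂ eq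
      with refl ← ≤-antisym l₁ u₁ with refl ← ≤-antisym l₂ u₂ = ≈-refl
    contour-≈ {x} {i} {k = k} (edge {j = j} {y = y} {cs} {ts} refl σj ℓi ℓj c t) ℓx u k≤N p q l₁ u₁ l₂ u₂ eq
      with uc , ut , apart ← unique-disjoint (labels cs) (labels ts) u =
      compare (place p l₁ u₁) (place q l₂ u₂)
      where
      j<k = contour-≤ t
      i<j = contour-≤ c
      data Place (r : ℕ) : Set where
        child   : suc i ≤ r → r ≤ j → Place r
        sibling : ∀ r′ → r ≈ r′ → ℓ r ≡ ℓ r′ → suc j ≤ r′ → r′ ≤ k → Place r
      place : ∀ r → i ≤ r → r ≤ k → Place r
      place r i≤r r≤k with m≤n⇒m<n∨m≡n i≤r
      ... | inj₂ refl = sibling (suc j) (glued i (<-≤-trans (<-trans i<j j<k) k≤N)) (trans ℓx (sym ℓj)) ≤-refl j<k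
      ... | inj₁ i<r with r ≤? j
      ...   | yes r≤j = child i<r r≤j
      ...   | no r≰j  = sibling r ≈-refl refl (≰⇒> r≰j) r≤k
      compare : Place p → Place q → p ≈ q
      compare (child a b) (child a′ b′) =
        contour-≈ c ℓi uc (≤-trans (<⇒≤ j<k) k≤N) p q a b a′ b′ eq
      compare (child a b) (sibling q′ _ e a′ b′) =
        ⊥-elim (apart (contour-label ℓi c p a b) (subst (_∈ x ∷ labels ts) (sym (trans eq e)) (contour-label ℓj t q′ a′ b′)))
      compare (sibling p′ _ e a b) (child a′ b′) =
        ⊥-elim (apart (contour-label ℓi c q a′ b′) (subst (_∈ x ∷ labels ts) (trans (sym e) eq) (contour-label ℓj t p′ a b)))
      compare (sibling p′ r e a b) (sibling q′ r′ e′ a′ b′) =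
        ≈-trans r (≈-trans (contour-≈ t ℓj ut k≤N p′ q′ a b a′ b′ (trans (sym e) (trans eq e′))) (≈-sym r′))

  contour-det : ∀ {x i F F′ k} → Contour σ ℓ x i F k → Contour σ ℓ x i F′ k → F ≡ F′
  contour-det [] [] = refl
  contour-det [] (edge _ _ _ _ c t) = contradiction (≤-trans (contour-≤ c) (<⇒≤ (contour-≤ t))) 1+n≰n
  contour-det (edge _ _ _ _ c t) [] = contradiction (≤-trans (contour-≤ c) (<⇒≤ (contour-≤ t))) 1+n≰n
  contour-det (edge refl _ refl _ c t) (edge refl _ refl _ c′ t′) =
    cong₂ (λ F G → node _ F ∷ G) (contour-det c c′) (contour-det t t′)

  contour-relabel : ∀ {B : Set} (f : A → B) {x i F k} → Contour σ ℓ x i F k →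
    Contour σ (f ∘ ℓ) (f x) i (relabel f F) k
  contour-relabel f [] = []
  contour-relabel f (edge σi σj ℓi ℓj c t) =
    edge σi σj (cong f ℓi) (cong f ℓj) (contour-relabel f c) (contour-relabel f t)

endOf : ∀ {A : Set} → ℕ → Forest A → ℕ
endOf i []               = i
endOf i (node _ cs ∷ ts) = endOf (suc (endOf (suc i) cs)) ts

endOf-labels : ∀ {A : Set} i (F : Forest A) → endOf i F ≡ i + 2 * length (labels F)
endOf-labels i []               = sym (+-identityʳ i)
endOf-labels i (node y cs ∷ ts)
  rewrite endOf-labels (suc (endOf (suc i) cs)) ts | endOf-labels (suc i) cs | length-++ (labels cs) {labels ts} =
  solve 3 (λ i c t → con 1 :+ (con 1 :+ i :+ con 2 :* c) :+ con 2 :* t := i :+ con 2 :* (con 1 :+ (c :+ t))) refl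
    i (length (labels cs)) (length (labels ts))

contour-endOf : ∀ {A : Set} {σ} {ℓ : ℕ → A} {x i F k} → Contour σ ℓ x i F k → k ≡ endOf i F
contour-endOf [] = refl
contour-endOf (edge _ _ _ _ c t) with refl ← contour-endOf c = contour-endOf t

contour-codet : ∀ {A : Set} {σ σ′} {ℓ ℓ′ : ℕ → A} {x i F k} → ℓ i ≡ x → ℓ′ i ≡ x →
  Contour σ ℓ x i F k → Contour σ′ ℓ′ x i F k →
  ∀ p → i ≤ p → (p < k → σ p ≡ σ′ p) × (p ≤ k → ℓ p ≡ ℓ′ p)
contour-codet ℓi ℓ′i [] [] p i≤p =
  (λ p<i → contradiction i≤p (<⇒≱ p<i)) , λ p≤i → at-start (≤-antisym i≤p p≤i)
  where
  at-start : ∀ {p} → _ ≡ p → _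
  at-start refl = trans ℓi (sym ℓ′i)
contour-codet {σ = σ} {σ′} {ℓ} {ℓ′} {i = i} {k = k} ℓx ℓ′x (edge {j = j} σi σj ℓi ℓj c t) (edge {j = j′} σ′i σ′j ℓ′i ℓ′j c′ t′) p i≤p
  with refl ← trans (contour-endOf c) (sym (contour-endOf c′)) =
  (λ p<k → σ-agree (region j i≤p p<k)) , ℓ-agree
  where
  σ-agree : Region i j k p → σ p ≡ σ′ p
  σ-agree (first refl) = trans σi (sym σ′i)
  σ-agree (last refl)  = trans σj (sym σ′j)
  σ-agree (inside l u) = proj₁ (contour-codet ℓi ℓ′i c c′ p l) u
  σ-agree (after l u)  = proj₁ (contour-codet ℓj ℓ′j t t′ p l) u
  ℓ-agree : p ≤ k → ℓ p ≡ ℓ′ p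
  ℓ-agree p≤k with m≤n⇒m<n∨m≡n i≤p
  ... | inj₂ refl = trans ℓx (sym ℓ′x)
  ... | inj₁ i<p with p ≤? j
  ...   | yes p≤j = proj₂ (contour-codet ℓi ℓ′i c c′ p i<p) p≤j
  ...   | no p≰j  = proj₂ (contour-codet ℓj ℓ′j t t′ p (≰⇒> p≰j)) p≤k

-- Contours of given forests

Agrees : ∀ {A : Set} → (ℕ → A) → ℕ → List A → Set
Agrees f i []       = ⊤
Agrees f i (a ∷ as) = f i ≡ a × Agrees f (suc i) as

nth : ∀ {A : Set} → A → List A → ℕ → A
nth d []       n       = d
nth d (x ∷ xs) zero    = x
nth d (x ∷ xs) (suc n) = nth d xs n

agrees-suc : ∀ {A : Set} {f : ℕ → A} i xs → Agrees (f ∘ suc) i xs → Agrees f (suc i) xs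
agrees-suc i []       ag        = tt
agrees-suc i (x ∷ xs) (eq , ag) = eq , agrees-suc (suc i) xs ag

agrees-nth : ∀ {A : Set} (d : A) xs → Agrees (nth d xs) 0 xs
agrees-nth d []       = tt
agrees-nth d (x ∷ xs) = refl , agrees-suc 0 xs (agrees-nth d xs)

agrees-unique : ∀ {A : Set} {f : ℕ → A} i xs ys → length xs ≡ length ys → Agrees f i xs → Agrees f i ys → xs ≡ ys
agrees-unique i []       []       _  _         _          = refl
agrees-unique i (x ∷ xs) (y ∷ ys) eq (refl , a) (refl , b) =
  cong (x ∷_) (agrees-unique (suc i) xs ys (suc-injective eq) a b)

-- The values of the matching in contour order, with `v` for what comes after the forest; this
-- accumulating form lets `contour-lists` consume the list along the traversal.
partners : ∀ {A : Set} → ℕ → Forest A → List ℕ → List ℕ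
partners i []               v = v
partners i (node _ cs ∷ ts) v =
  endOf (suc i) cs ∷ partners (suc i) cs (i ∷ partners (suc (endOf (suc i) cs)) ts v)

corners : ∀ {A : Set} → A → Forest A → List A → List A
corners x []               v = v
corners x (node y cs ∷ ts) v = y ∷ corners y cs (x ∷ corners x ts v)

contour-lists : ∀ {A : Set} {σ} {ℓ : ℕ → A} x i F {v u} → Agrees σ i (partners i F v) → Agrees ℓ (suc i) (corners x F u) →
  Contour σ ℓ x i F (endOf i F) × Agrees σ (endOf i F) v × Agrees ℓ (suc (endOf i F)) u
contour-lists x i []               a b = [] , a , b
contour-lists x i (node y cs ∷ ts) (σi , a) (ℓi , b)
  with c , (σj , a′) , (ℓj , b′) ← contour-lists y (suc i) cs a b
  with t , a″ , b″ ← contour-lists x _ ts a′ b′ = edge σi σj ℓi ℓj c t , a″ , b″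

length-wordF : ∀ {A : Set} (c : A → A → Bool) d F k i → i + length (wordF c d F k) ≡ endOf i F + length k
length-wordF c d []               k i = refl
length-wordF c d (node y cs ∷ ts) k i = begin
  i + suc (length (wordF c (c y) cs (_ ∷ wordF c d ts k)))    ≡⟨ +-suc i _ ⟩
  suc i + length (wordF c (c y) cs (_ ∷ wordF c d ts k))      ≡⟨ length-wordF c (c y) cs _ (suc i) ⟩
  endOf (suc i) cs + suc (length (wordF c d ts k))            ≡⟨ +-suc _ _ ⟩
  suc (endOf (suc i) cs) + length (wordF c d ts k)            ≡⟨ length-wordF c d ts k _ ⟩
  endOf (suc (endOf (suc i) cs)) ts + length k                ∎
  where open ≡-Reasoning

contour-word : ∀ {A : Set} {σ} {ℓ : ℕ → A} {e} (c : A → A → Bool) {x i F k v} → ℓ i ≡ x →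
  Contour σ ℓ x i F k →
  (∀ p → i ≤ p → p < k → e p ≡ opening (c (ℓ p) (ℓ (suc p)))) → (∀ p → i ≤ p → p < k → e (σ p) ≡ op (e p)) →
  Agrees e k v → Agrees e i (wordF c (c x) F v)
contour-word c ℓx [] ho hc ag = ag
contour-word {σ = σ} {ℓ} {e} c {x} {i} ℓx (edge {j = j} refl _ refl ℓj cs ts) ho hc ag =
  e-open , contour-word c refl cs (λ p l u → ho p (<⇒≤ l) (<-trans u j<k)) (λ p l u → hc p (<⇒≤ l) (<-trans u j<k))
    ( trans (hc i ≤-refl (<-trans i<j j<k)) (cong op e-open)
    , contour-word c ℓj ts (λ p l u → ho p (≤-trans (<⇒≤ i<j) (<⇒≤ l)) u) (λ p l u → hc p (≤-trans (<⇒≤ i<j) (<⇒≤ l)) u) ag)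
  where
  i<j = contour-≤ cs
  j<k = contour-≤ ts
  e-open : e i ≡ opening (c x (ℓ (suc i)))
  e-open = trans (ho i ≤-refl (<-trans i<j j<k)) (cong (λ z → opening (c z (ℓ (suc i)))) ℓx)

contour-op : ∀ {A : Set} {σ} {ℓ : ℕ → A} {e} (c : A → A → Bool) d {x i F k v} →
  Contour σ ℓ x i F k → Agrees e i (wordF c d F v) →
  Agrees e k v × (∀ p → i ≤ p → p < k → e (σ p) ≡ op (e p))
contour-op c d [] ag = ag , λ p i≤p p<i → contradiction i≤p (<⇒≱ p<i)
contour-op {σ = σ} {e = e} c d {i = i} {k = k} (edge {j = j} {y = y} σi σj _ _ cs ts) (ei , ag)
  with (ej , ag′) , inner ← contour-op c (c y) cs ag
  with ag″ , outer ← contour-op c d ts ag′ = ag″ , λ p l u → go p (region j l u)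
  where
  go : ∀ p → Region i j k p → e (σ p) ≡ op (e p)
  go p (first refl) = trans (cong e σi) (trans ej (cong op (sym ei)))
  go p (last refl)  = trans (cong e σj) (trans ei (trans (sym (op-involutive _)) (cong op (sym ej))))
  go p (inside l u) = inner p l u
  go p (after l u)  = outer p l u

contour-steps : ∀ {A : Set} {σ} {ℓ : ℕ → A} {e} (c : A → A → Bool) (_<′_ : A → A → Set) →
  (∀ {x y} → x ≢ y → opening (c x y) ≡ U → x <′ y) → (∀ {x y} → x ≢ y → opening (c x y) ≡ D → y <′ x) →
  ∀ {x i F k v} → ℓ i ≡ x → Unique (x ∷ labels F) →
  Contour σ ℓ x i F k → Agrees e i (wordF c (c x) F v) →
  Agrees e k v × (∀ p → i ≤ p → p < k → (e p ≡ U → ℓ p <′ ℓ (suc p)) × (e p ≡ D → ℓ (suc p) <′ ℓ p))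
contour-steps c _<′_ up down ℓx u [] ag = ag , λ p i≤p p<i → contradiction i≤p (<⇒≱ p<i)
contour-steps {σ = σ} {ℓ} {e} c _<′_ up down {x} {i} {k = k} ℓx u@((x≢y ∷ _) ∷ _) (edge {j = j} {y = y} {cs} {ts} σi σj ℓi ℓj con-c con-t) (ei , ag)
  with uc , ut , _ ← unique-disjoint {σ = σ} {ℓ} (labels cs) (labels ts) u
  with (ej , ag′) , inner ← contour-steps c _<′_ up down ℓi uc con-c ag
  with ag″ , outer ← contour-steps c _<′_ up down ℓj ut con-t ag′ = ag″ , λ p l u → go p (region j l u)
  where
  ℓj′ : ℓ j ≡ y
  ℓj′ = contour-end ℓi con-c
  op-eq : ∀ {a b} → op a ≡ b → a ≡ op b
  op-eq {a} refl = sym (op-involutive a)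
  go : ∀ p → Region i j k p → (e p ≡ U → ℓ p <′ ℓ (suc p)) × (e p ≡ D → ℓ (suc p) <′ ℓ p)
  go p (first refl) = (λ h → subst₂ _<′_ (sym ℓx) (sym ℓi) (up x≢y (trans (sym ei) h)))
                    , (λ h → subst₂ _<′_ (sym ℓi) (sym ℓx) (down x≢y (trans (sym ei) h)))
  go p (last refl)  = (λ h → subst₂ _<′_ (sym ℓj′) (sym ℓj) (down x≢y (op-eq (trans (sym ej) h))))
                    , (λ h → subst₂ _<′_ (sym ℓj) (sym ℓj′) (up x≢y (op-eq (trans (sym ej) h))))
  go p (inside l u) = inner p l u
  go p (after l u)  = outer p l u

-- Parsing a non-crossing matching

record NonCrossingOn (σ : ℕ → ℕ) (N : ℕ) : Set where
  field
    bounded     : ∀ {p} → p < N → σ p < N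
    involutive  : ∀ {p} → p < N → σ (σ p) ≡ p
    fixfree     : ∀ {p} → p < N → σ p ≢ p
    noncrossing : ∀ {p q} → p < q → q < σ p → σ p < σ q → σ q < N → ⊥

module _ {A : Set} {σ : ℕ → ℕ} {ℓ : ℕ → A} {N : ℕ} (nc : NonCrossingOn σ N)
         (returns : ∀ i → i < σ i → σ i < N → ℓ (suc (σ i)) ≡ ℓ i) where
  open NonCrossingOn nc

  -- The edges from `i` up to `k` are matched among themselves. The pair of `i` and `j = σ i` cuts
  -- this interval into two that are again closed under the matching, one for the subtree of the
  -- first child and one for its siblings. The fuel bounds the length of the interval.
  parse : ∀ fuel {x} i k → k ≤ N → i ≤ k → k ≤ fuel + i → ℓ i ≡ x →
    (∀ p → i ≤ p → p < k → i ≤ σ p × σ p < k) → ∃ λ F → Contour σ ℓ x i F k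
  parse fuel i k k≤N i≤k le ℓx closed with m≤n⇒m<n∨m≡n i≤k
  ... | inj₂ refl = [] , []
  parse zero       i k k≤N i≤k le ℓx closed | inj₁ i<k = contradiction le (<⇒≱ i<k)
  parse (suc fuel) i k k≤N i≤k le ℓx closed | inj₁ i<k =
    let cs , c = parse fuel (suc i) j (≤-trans (<⇒≤ j<k) k≤N) i<j
                   (≤-trans (<⇒≤ j<k) le′) refl inner
        ts , t = parse fuel (suc j) k k≤N j<k
                   (≤-trans le′ (+-monoʳ-≤ fuel (s≤s (<⇒≤ i<j)))) ℓj outer
    in node (ℓ (suc i)) cs ∷ ts , edge refl σj refl ℓj c t
    where
    j = σ i
    i<N = <-≤-trans i<k k≤N
    j<k = proj₂ (closed i ≤-refl i<k)
    σj = involutive i<N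
    i<j : i < j
    i<j = ≤∧≢⇒< (proj₁ (closed i ≤-refl i<k)) (λ eq → fixfree i<N (sym eq))
    ℓj = trans (returns i i<j (<-≤-trans j<k k≤N)) ℓx
    le′ : k ≤ fuel + suc i
    le′ = ≤-trans le (≤-reflexive (sym (+-suc fuel i)))
    σ-injective : ∀ {p q} → p < N → q < N → σ p ≡ σ q → p ≡ q
    σ-injective p<N q<N eq = trans (sym (involutive p<N)) (trans (cong σ eq) (involutive q<N))
    ≢i : ∀ {p} → p < N → p ≢ j → σ p ≢ i
    ≢i p<N p≢j eq = p≢j (σ-injective p<N (bounded i<N) (trans eq (sym σj)))
    ≢j : ∀ {p} → p < N → i < p → σ p ≢ j
    ≢j p<N i<p eq = <⇒≢ i<p (sym (σ-injective p<N i<N eq))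
    inner : ∀ p → suc i ≤ p → p < j → suc i ≤ σ p × σ p < j
    inner p i<p p<j with l , u ← closed p (<⇒≤ i<p) (<-trans p<j j<k) =
      ≤∧≢⇒< l (λ eq → ≢i p<N (<⇒≢ p<j) (sym eq)) , below (<-cmp (σ p) j)
      where
      p<N = <-≤-trans (<-trans p<j j<k) k≤N
      below : _ → σ p < j
      below (tri< lt _ _) = lt
      below (tri≈ _ eq _) = contradiction eq (≢j p<N i<p)
      -- Otherwise the pair of `p` would cross the pair of `i` and `j`.
      below (tri> _ _ gt) = ⊥-elim (noncrossing i<p p<j gt (<-≤-trans u k≤N))
    outer : ∀ p → suc j ≤ p → p < k → suc j ≤ σ p × σ p < k
    outer p j<p p<k with l , u ← closed p (≤-trans (<⇒≤ i<j) (<⇒≤ j<p)) p<k = above (<-cmp (σ p) j) , u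
      where
      p<N = <-≤-trans p<k k≤N
      above : _ → suc j ≤ σ p
      above (tri> _ _ gt) = gt
      above (tri≈ _ eq _) = contradiction eq (≢j p<N (<-trans i<j j<p))
      -- A partner strictly inside the first pair would itself be matched inside, by `inner`,
      -- although it is matched to `p` beyond `j`.
      above (tri< lt _ _) = contradiction (subst (_< j) (involutive p<N) (proj₂ (inner (σ p) i<σp lt))) (<-asym j<p)
        where
        i<σp : i < σ p
        i<σp = ≤∧≢⇒< l (λ eq → ≢i p<N (>⇒≢ j<p) (sym eq))

val : Letter → ℤ
val U = 1ℤ
val D = -1ℤ

-- Cyclic positions

next-toℕ : ∀ {k} (i : Fin k) →
  (suc (toℕ i) < k × toℕ (next i) ≡ suc (toℕ i)) ⊎ (suc (toℕ i) ≡ k × toℕ (next i) ≡ 0)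
next-toℕ {suc n} i with toℕ i <? n
... | yes p = inj₁ (s≤s p , toℕ-fromℕ< (s≤s p))
... | no ¬p = inj₂ (cong suc (≤-antisym (≤-pred (toℕ<n i)) (≮⇒≥ ¬p)) , refl)

module Positions {k : ℕ} (pos : 0 < k) where

  -- Positions outside the polygon go to 0. This matters for position `k`: the contour ends at the
  -- corner where it began.
  fin : ℕ → Fin k
  fin p with p <? k
  ... | yes q = fromℕ< q
  ... | no _  = fromℕ< pos

  toℕ-fin : ∀ {p} → p < k → toℕ (fin p) ≡ p
  toℕ-fin {p} q with p <? k
  ... | yes q′ = toℕ-fromℕ< q′
  ... | no ¬q  = contradiction q ¬q

  fin-toℕ : ∀ i → fin (toℕ i) ≡ i
  fin-toℕ i = toℕ-injective (toℕ-fin (toℕ<n i))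

  fin-k : fin k ≡ fin 0
  fin-k with k <? k
  ... | yes q = contradiction q (<-irrefl refl)
  ... | no _  = toℕ-injective (trans (toℕ-fromℕ< pos) (sym (toℕ-fin pos)))

  next-fin : ∀ i → next i ≡ fin (suc (toℕ i))
  next-fin i with next-toℕ i
  ... | inj₁ (lt , eq) = toℕ-injective (trans eq (sym (toℕ-fin lt)))
  ... | inj₂ (ek , eq) = trans (toℕ-injective (trans eq (sym (toℕ-fin pos)))) (sym (trans (cong fin ek) fin-k))

  at-next : ∀ {A : Set} (ℓ : ℕ → A) → ℓ k ≡ ℓ 0 → ∀ i → ℓ (toℕ (next i)) ≡ ℓ (suc (toℕ i))
  at-next ℓ wrap i with next-toℕ i
  ... | inj₁ (_ , eq)  = cong ℓ eq
  ... | inj₂ (ek , eq) = trans (cong ℓ eq) (trans (sym wrap) (cong ℓ (sym ek)))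

  glued-label : ∀ {A : Set} {τ : Fin k → Fin k} {σ} {ℓ : ℕ → A} {x F} →
    (∀ i → toℕ (τ i) ≡ σ (toℕ i)) → ℓ 0 ≡ x → Contour σ ℓ x 0 F k →
    ∀ {i j} → i ∼[ τ ] j → ℓ (toℕ i) ≡ ℓ (toℕ j)
  glued-label {τ = τ} {σ} {ℓ} agree ℓ0 c =
    EqC.gfold isEquivalence (ℓ ∘ toℕ) λ { (glue i) → begin
      ℓ (toℕ i)            ≡⟨ contour-glue ℓ0 c (toℕ i) z≤n (toℕ<n i) ⟩
      ℓ (suc (σ (toℕ i)))  ≡⟨ cong (ℓ ∘ suc) (sym (agree i)) ⟩
      ℓ (suc (toℕ (τ i)))  ≡⟨ sym (at-next ℓ (trans (contour-end ℓ0 c) (sym ℓ0)) (τ i)) ⟩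
      ℓ (toℕ (next (τ i))) ∎ }
    where open ≡-Reasoning

lookup-nth : ∀ E w → E ≡ map val w → ∀ i → lookup E i ≡ val (nth U w (toℕ i))
lookup-nth _ (a ∷ w) refl Fin.zero    = refl
lookup-nth _ (a ∷ w) refl (Fin.suc i) = lookup-nth _ w refl i

-- Labellings by `Fin L`, each label occurring once.

module _ {L : ℕ} where

  occurrences-++ : ∀ (z : Fin L) xs ys → occurrences z (xs ++ ys) ≡ occurrences z xs + occurrences z ys
  occurrences-++ z []       ys = refl
  occurrences-++ z (x ∷ xs) ys = trans (cong (δ z x +_) (occurrences-++ z xs ys)) (sym (+-assoc (δ z x) _ _))

  countF-labels : ∀ (z : Fin L) F → countF z F ≡ occurrences z (labels F)
  countF-labels z []               = refl
  countF-labels z (node y cs ∷ ts) = cong (δ z y +_)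
    (trans (cong₂ _+_ (countF-labels z cs) (countF-labels z ts)) (sym (occurrences-++ z (labels cs) (labels ts))))

  occurrences⇒unique : ∀ (xs : List (Fin L)) → (∀ z → occurrences z xs ≤ 1) → Unique xs
  occurrences⇒unique []       le = []
  occurrences⇒unique (x ∷ xs) le =
    All.tabulate (λ z∈ eq → fresh le (subst (_∈ xs) (sym eq) z∈)) ∷ occurrences⇒unique xs (occurs-tail xs le)

  occurrences⇒∈ : ∀ {z : Fin L} xs → 1 ≤ occurrences z xs → z ∈ xs
  occurrences⇒∈ {z} (x ∷ xs) le with z ≟ x
  ... | yes refl = here refl
  ... | no z≢x   = there (occurrences⇒∈ xs le)

  unique⇒occurrences : ∀ (xs : List (Fin L)) → Unique xs → ∀ z → occurrences z xs ≤ 1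
  unique⇒occurrences []       []       z = z≤n
  unique⇒occurrences (x ∷ xs) (x∉ ∷ u) z with z ≟ x
  ... | no _     = unique⇒occurrences xs u z
  ... | yes refl = s≤s (none xs x∉)
    where
    none : ∀ xs → All (z ≢_) xs → occurrences z xs ≤ 0
    none []       []       = z≤n
    none (y ∷ xs) (ne ∷ a) rewrite δ-≢ ne = none xs a

  ∈⇒occurrences : ∀ {z : Fin L} {xs} → z ∈ xs → 1 ≤ occurrences z xs
  ∈⇒occurrences {z} (here refl)          = ≤-trans (≤-reflexive (sym (δ-refl z))) (m≤m+n _ _)
  ∈⇒occurrences {z} (there {x = x} z∈)   = ≤-trans (∈⇒occurrences z∈) (m≤n+m _ (δ z x))

  -- A missing label could be added in front, giving one distinct label more than `Fin L` has
  -- elements.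
  unique-full : ∀ (xs : List (Fin L)) → Unique xs → length xs ≡ L → ∀ z → z ∈ xs
  unique-full xs u len z = occurrences⇒∈ xs (n≢0⇒n>0 λ none →
    let i , j , i<j , eq = pigeonhole (≤-reflexive (cong suc (sym len))) (lookup (z ∷ xs))
    in lookup-distinct (z ∷ xs) (All.tabulate (λ { v∈ refl → contradiction (subst (1 ≤_) none (∈⇒occurrences v∈)) λ () }) ∷ u) i<j eq)
    where
    lookup-distinct : ∀ (ys : List (Fin L)) → Unique ys → ∀ {i j} → i Fin.< j → lookup ys i ≢ lookup ys j
    lookup-distinct (y ∷ ys) (y∉ ∷ u) {Fin.zero}  {Fin.suc j} _       = All.lookup y∉ (∈-lookup j)
    lookup-distinct (y ∷ ys) (y∉ ∷ u) {Fin.suc i} {Fin.suc j} (s≤s p) = lookup-distinct ys u p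

  -- Infinite descent: from f x < g x one finds x′ with f x′ < g x′ and f x′ < f x.
  not-below : ∀ {X : Set} (f g : X → Fin L) → (∀ z → ∃ λ x → g x ≡ z) →
    (∀ x y → g x Fin.< g y → f x Fin.< f y) → ∀ n x → toℕ (f x) < n → ¬ f x Fin.< g x
  not-below f g sg gf (suc n) x (s≤s le) lt with x′ , eq ← sg (f x) =
    not-below f g sg gf n x′ (<-≤-trans smaller le) (subst (λ v → f x′ Fin.< v) (sym eq) smaller)
    where
    smaller : f x′ Fin.< f x
    smaller = gf x′ x (subst (Fin._< g x) (sym eq) lt)

  -- Surjective labels are ranks, so the order of the vertices determines them; this recovers the
  -- labelling of the tree from the order alone.
  ordered-labels : ∀ {X : Set} (f g : X → Fin L) → (∀ z → ∃ λ x → f x ≡ z) → (∀ z → ∃ λ x → g x ≡ z) →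
    (∀ x y → f x Fin.< f y → g x Fin.< g y) → (∀ x y → g x Fin.< g y → f x Fin.< f y) → ∀ x → f x ≡ g x
  ordered-labels f g sf sg fg gf x with Fin.<-cmp (f x) (g x)
  ... | tri≈ _ eq _ = eq
  ... | tri< lt _ _ = ⊥-elim (not-below f g sg gf L x (toℕ<n (f x)) lt)
  ... | tri> _ _ gt = ⊥-elim (not-below g f sf fg L x (toℕ<n (g x)) gt)

  smaller-child : Fin L → Fin L → Bool
  smaller-child y z = toℕ z <ᵇ toℕ y

contour-cong : ∀ {A : Set} {σ σ′} {ℓ ℓ′ : ℕ → A} {x i F k} → (∀ p → p < k → σ p ≡ σ′ p) → (∀ p → p ≤ k → ℓ p ≡ ℓ′ p) →
  Contour σ ℓ x i F k → Contour σ′ ℓ′ x i F k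
contour-cong eσ eℓ [] = []
contour-cong eσ eℓ (edge σi σj ℓi ℓj c t) =
  edge (trans (sym (eσ _ (<-trans i<j j<k))) σi) (trans (sym (eσ _ j<k)) σj)
    (trans (sym (eℓ _ (≤-trans i<j (<⇒≤ j<k)))) ℓi) (trans (sym (eℓ _ j<k)) ℓj)
    (contour-cong (λ p u → eσ p (<-trans u j<k)) (λ p u → eℓ p (≤-trans u (<⇒≤ j<k))) c) (contour-cong eσ eℓ t)
  where
  i<j = contour-≤ c
  j<k = contour-≤ t

-- Pairs (σ, <) against labelled trees with contour word `w`.

module Correspondence {m} (l : Fin m → ℕ) (w : List Letter) (eps : epsList l ≡ map val w) (pos : 0 < K l) where

  open Positions pos

  private
    L = Lsize l
    N = K l

  e : ℕ → Letter
  e = nth U w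

  εm-val : ∀ i → εm l i ≡ val (e (toℕ i))
  εm-val = lookup-nth (epsList l) w eps

  length-w : length w ≡ N
  length-w = trans (sym (length-map val w)) (cong length (sym eps))

  Once : Fin L → Forest (Fin L) → Set
  Once x cs = ∀ z → δ z x + countF z cs ≡ 1

  -- A relation rather than a map, because `σ` and `ℓ` arise in two ways: from the tree in
  -- `realise`, and from the pair in `Recover`. It is single-valued in both directions, up to `≈α`
  -- on the side of the pairs.
  record Corresponds (a : Alpha l) (x : Fin L) (cs : Forest (Fin L)) : Set where
    field
      σ       : ℕ → ℕ
      ℓ       : ℕ → Fin L
      pairs   : ∀ i → toℕ (Alpha.σ a i) ≡ σ (toℕ i)
      orders  : ∀ i j → Alpha.order a i j ⇔ ℓ (toℕ i) Fin.< ℓ (toℕ j)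
      root    : ℓ 0 ≡ x
      contour : Contour σ ℓ x 0 cs N
      reads   : wordF smaller-child (smaller-child x) cs [] ≡ w
      once    : Once x cs

  once-unique : ∀ x cs → Once x cs → Unique (x ∷ labels cs)
  once-unique x cs once = occurrences⇒unique (x ∷ labels cs)
    (λ z → ≤-reflexive (trans (cong (δ z x +_) (sym (countF-labels z cs))) (once z)))

  surjective : ∀ {a x cs} (c : Corresponds a x cs) → ∀ z → ∃ λ i → Corresponds.ℓ c (toℕ i) ≡ z
  surjective {x = x} {cs} c z = at (occurrences⇒∈ (x ∷ labels cs)
    (≤-reflexive (trans (sym (once z)) (cong (δ z x +_) (countF-labels z cs)))))
    where
    open Corresponds c
    at : z ∈ x ∷ labels cs → ∃ λ i → ℓ (toℕ i) ≡ z
    at (here refl) = fin 0 , trans (cong ℓ (toℕ-fin pos)) root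
    at (there z∈) with p , _ , p≤N , eq ← contour-∈ contour z∈ with m≤n⇒m<n∨m≡n p≤N
    ... | inj₁ p<N  = fin p , trans (cong ℓ (toℕ-fin p<N)) eq
    ... | inj₂ refl = fin 0 , trans (cong ℓ (toℕ-fin pos)) (trans root (trans (sym (contour-end root contour)) eq))

  on-corners : ∀ {A : Set} {f g : ℕ → A} → (∀ i → f (toℕ {N} i) ≡ g (toℕ i)) → ∀ p → p < N → f p ≡ g p
  on-corners {f = f} {g} eq p p<N = trans (cong f (sym (toℕ-fin p<N))) (trans (eq (fin p)) (cong g (toℕ-fin p<N)))

  corresponds-det : ∀ {a a′ x x′ cs cs′} → a ≈α a′ → Corresponds a x cs → Corresponds a′ x′ cs′ →
    node x cs ≡ node x′ cs′
  corresponds-det {x = x} {x′} {cs} {cs′} (eσ , eo) c c′ = same-root ℓ0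
      (subst (λ v → Contour C′.σ C′.ℓ v 0 cs N) ℓ0 (contour-cong
        (on-corners (λ i → trans (sym (C.pairs i)) (trans (cong toℕ (eσ i)) (C′.pairs i)))) ℓ≤ C.contour))
    where
    module C  = Corresponds c
    module C′ = Corresponds c′
    ℓ≡ : ∀ i → C.ℓ (toℕ {N} i) ≡ C′.ℓ (toℕ i)
    ℓ≡ = ordered-labels (C.ℓ ∘ toℕ) (C′.ℓ ∘ toℕ) (surjective c) (surjective c′)
      (λ i j lt → Equivalence.to (C′.orders i j) (Equivalence.to (eo i j) (Equivalence.from (C.orders i j) lt)))
      (λ i j lt → Equivalence.to (C.orders i j) (Equivalence.from (eo i j) (Equivalence.from (C′.orders i j) lt)))
    ℓ0 : x ≡ x′
    ℓ0 = trans (sym C.root) (trans (on-corners {f = C.ℓ} {C′.ℓ} ℓ≡ 0 pos) C′.root)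
    ℓ≤ : ∀ p → p ≤ N → C.ℓ p ≡ C′.ℓ p
    ℓ≤ p p≤N with m≤n⇒m<n∨m≡n p≤N
    ... | inj₁ p<N  = on-corners {f = C.ℓ} {C′.ℓ} ℓ≡ p p<N
    ... | inj₂ refl = trans (contour-end C.root C.contour) (trans ℓ0 (sym (contour-end C′.root C′.contour)))
    same-root : x ≡ x′ → Contour C′.σ C′.ℓ x′ 0 cs N → node x cs ≡ node x′ cs′
    same-root refl c″ = cong (node x) (contour-det c″ C′.contour)

  corresponds-codet : ∀ {a a′ x cs} → Corresponds a x cs → Corresponds a′ x cs → a ≈α a′
  corresponds-codet c c′ =
    (λ i → toℕ-injective (trans (C.pairs i) (trans (proj₁ (agree (toℕ i)) (toℕ<n i)) (sym (C′.pairs i)))))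
    , λ i j → mk⇔
        (λ o → Equivalence.from (C′.orders i j) (subst₂ Fin._<_ (ℓ≡ i) (ℓ≡ j) (Equivalence.to (C.orders i j) o)))
        (λ o → Equivalence.from (C.orders i j) (subst₂ Fin._<_ (sym (ℓ≡ i)) (sym (ℓ≡ j)) (Equivalence.to (C′.orders i j) o)))
    where
    module C  = Corresponds c
    module C′ = Corresponds c′
    agree : ∀ p → (p < N → C.σ p ≡ C′.σ p) × (p ≤ N → C.ℓ p ≡ C′.ℓ p)
    agree p = contour-codet C.root C′.root C.contour C′.contour p z≤n
    ℓ≡ : ∀ (i : Fin N) → C.ℓ (toℕ i) ≡ C′.ℓ (toℕ i)
    ℓ≡ i = proj₂ (agree (toℕ i)) (<⇒≤ (toℕ<n i))

  val-op : ∀ a b → b ≡ op a → val a ℤ.+ val b ≡ 0ℤ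
  val-op U _ refl = refl
  val-op D _ refl = refl

  val-injective : ∀ {a b} → val a ≡ val b → a ≡ b
  val-injective {U} {U} _ = refl
  val-injective {D} {D} _ = refl

  smaller-child-U : ∀ {x y : Fin L} → x ≢ y → opening (smaller-child x y) ≡ U → x Fin.< y
  smaller-child-U {x} {y} x≢y eq with toℕ y <ᵇ toℕ x in lt
  ... | false = ≤∧≢⇒< (≮⇒≥ λ y<x → subst T lt (<⇒<ᵇ y<x)) (x≢y ∘ toℕ-injective)

  smaller-child-D : ∀ {x y : Fin L} → x ≢ y → opening (smaller-child x y) ≡ D → y Fin.< x
  smaller-child-D {x} {y} x≢y eq with toℕ y <ᵇ toℕ x in lt
  ... | true = <ᵇ⇒< (toℕ y) (toℕ x) (subst T (sym lt) tt)

  realise : ∀ x cs → wordF smaller-child (smaller-child x) cs [] ≡ w → Once x cs → ∃ λ a → Corresponds a x cs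
  realise x cs reads once = alpha , record
    { σ = σ ; ℓ = ℓ ; pairs = toℕ-σF ; orders = λ i j → mk⇔ (λ z → z) (λ z → z)
    ; root = refl ; contour = contour ; reads = reads ; once = once }
    where
    σ : ℕ → ℕ
    σ = nth 0 (partners 0 cs [])
    -- `corners` lists the labels from corner 1 on; the `x` in front is the label of corner 0.
    ℓ : ℕ → Fin L
    ℓ = nth x (x ∷ corners x cs [])
    end : endOf 0 cs ≡ N
    end = trans (sym (trans (length-wordF smaller-child (smaller-child x) cs [] 0) (+-identityʳ _)))
                (trans (cong length reads) length-w)
    contour : Contour σ ℓ x 0 cs N
    contour = subst (Contour σ ℓ x 0 cs) end (proj₁ (contour-lists x 0 cs (agrees-nth 0 (partners 0 cs []))
      (proj₂ (agrees-nth x (x ∷ corners x cs [])))))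
    unique : Unique (x ∷ labels cs)
    unique = once-unique x cs once
    matched : ∀ (i : Fin N) → Matched {σ = σ} {ℓ} 0 N (toℕ i)
    matched i = contour-matched contour (toℕ i) z≤n (toℕ<n i)
    σF : Fin N → Fin N
    σF i = fromℕ< (Matched.upper (matched i))
    toℕ-σF : ∀ i → toℕ (σF i) ≡ σ (toℕ i)
    toℕ-σF i = toℕ-fromℕ< (Matched.upper (matched i))
    reads-e : Agrees e 0 (wordF smaller-child (smaller-child x) cs [])
    reads-e = subst (Agrees e 0) (sym reads) (agrees-nth U w)
    wraps : ℓ N ≡ ℓ 0
    wraps = contour-end refl contour

    ∼⇒≡ : ∀ {i j} → i ∼[ σF ] j → ℓ (toℕ i) ≡ ℓ (toℕ j)
    ∼⇒≡ = glued-label toℕ-σF refl contour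

    ≡⇒∼ : ∀ i j → ℓ (toℕ i) ≡ ℓ (toℕ j) → i ∼[ σF ] j
    ≡⇒∼ i j eq = subst₂ (_∼[ σF ]_) (fin-toℕ i) (fin-toℕ j)
      (contour-≈ contour refl unique ≤-refl (toℕ i) (toℕ j) z≤n (<⇒≤ (toℕ<n i)) z≤n (<⇒≤ (toℕ<n j)) eq)
      where
      glued : ∀ p → p < N → fin p ∼[ σF ] fin (suc (σ p))
      glued p p<N = subst (fin p ∼[ σF ]_) (trans (next-fin (σF (fin p)))
        (cong (fin ∘ suc) (trans (toℕ-σF (fin p)) (cong σ (toℕ-fin p<N))))) (EqC.return (glue (fin p)))
      open Identify {σ = σ} {ℓ} (λ p q → fin p ∼[ σF ] fin q) (EqC.reflexive _) (EqC.symmetric _) (EqC.transitive _) glued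

    steps : ∀ (i : Fin N) → (e (toℕ i) ≡ U → ℓ (toℕ i) Fin.< ℓ (toℕ (next i))) ×
                            (e (toℕ i) ≡ D → ℓ (toℕ (next i)) Fin.< ℓ (toℕ i))
    steps i rewrite at-next ℓ wraps i =
      proj₂ (contour-steps smaller-child Fin._<_ smaller-child-U smaller-child-D refl unique contour reads-e) (toℕ i) z≤n (toℕ<n i)

    arrow : ∀ {i j} → Arrow (εm l) i j → ℓ (toℕ j) Fin.< ℓ (toℕ i)
    arrow (plusE i ε≡)  = proj₁ (steps i) (val-injective (trans (sym (εm-val i)) ε≡))
    arrow (minusE i ε≡) = proj₂ (steps i) (val-injective (trans (sym (εm-val i)) ε≡))

    arrows : ∀ {i j} → TransClosure (ArrowT (εm l) σF) i j → ℓ (toℕ j) Fin.< ℓ (toℕ i)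
    arrows [ _ , _ , p , ar , q ]       = subst₂ Fin._<_ (∼⇒≡ q) (sym (∼⇒≡ p)) (arrow ar)
    arrows ((_ , _ , p , ar , q) ∷ rest) = <-trans (arrows rest) (subst₂ Fin._<_ (∼⇒≡ q) (sym (∼⇒≡ p)) (arrow ar))

    alpha : Alpha l
    alpha = record
      { σ        = σF
      ; pairing  = (λ i → toℕ-injective (trans (toℕ-σF (σF i)) (trans (cong σ (toℕ-σF i)) (Matched.involutive (matched i)))))
                 , (λ i eq → Matched.fixfree (matched i) (trans (sym (toℕ-σF i)) (cong toℕ eq)))
      ; compat   = λ i → trans (cong₂ ℤ._+_ (εm-val i) (εm-val (σF i)))
                     (val-op (e (toℕ i)) _ (trans (cong e (toℕ-σF i))
                       (proj₂ (contour-op smaller-child (smaller-child x) contour reads-e) (toℕ i) z≤n (toℕ<n i))))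
      ; noncross = λ (p , q , r , s , p<q , q<r , r<s , σp , σq) →
          let σp′ = trans (sym (toℕ-σF p)) (cong toℕ σp)
              σq′ = trans (sym (toℕ-σF q)) (cong toℕ σq)
          in contour-noncrossing contour z≤n p<q (subst (toℕ q <_) (sym σp′) q<r) (subst₂ _<_ (sym σp′) (sym σq′) r<s)
               (subst (_< N) (sym σq′) (toℕ<n s))
      ; order    = λ i j → ℓ (toℕ i) Fin.< ℓ (toℕ j)
      ; isOrder  = record
        { respects   = λ p q → subst₂ Fin._<_ (∼⇒≡ p) (∼⇒≡ q)
        ; irrefl     = λ p lt → <⇒≢ lt (cong toℕ (∼⇒≡ p))
        ; transitive = <-trans
        ; trichotomy = λ i j → trichotomous i j (Fin.<-cmp (ℓ (toℕ i)) (ℓ (toℕ j)))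
        ; compatible = arrows } }
      where
      trichotomous : ∀ i j → _ → (ℓ (toℕ i) Fin.< ℓ (toℕ j)) ⊎ (i ∼[ σF ] j) ⊎ (ℓ (toℕ j) Fin.< ℓ (toℕ i))
      trichotomous i j (tri< lt _ _) = inj₁ lt
      trichotomous i j (tri≈ _ eq _) = inj₂ (inj₁ (≡⇒∼ i j eq))
      trichotomous i j (tri> _ _ gt) = inj₂ (inj₂ gt)

-- The first corner of a vertex serves as its canonical representative; the first argument of
-- firstWithin is fuel, for which p itself suffices.
module FirstCorner (σ : ℕ → ℕ) where

  firstWithin : ℕ → ℕ → ℕ
  firstWithin n       zero    = 0
  firstWithin zero    (suc q) = 0
  firstWithin (suc n) (suc q) = if σ q <ᵇ q then firstWithin n (σ q) else suc q

  firstCorner : ℕ → ℕ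
  firstCorner p = firstWithin p p

  firstWithin-irrelevant : ∀ n n′ p → p ≤ n → p ≤ n′ → firstWithin n p ≡ firstWithin n′ p
  firstWithin-irrelevant n       n′       zero    _        _         = refl
  firstWithin-irrelevant (suc n) (suc n′) (suc q) (s≤s le) (s≤s le′) with σ q <ᵇ q in lt
  ... | false = refl
  ... | true  = firstWithin-irrelevant n n′ (σ q) (≤-trans σq≤q le) (≤-trans σq≤q le′)
    where
    σq≤q : σ q ≤ q
    σq≤q = <⇒≤ (<ᵇ⇒< (σ q) q (subst T (sym lt) tt))

  -- Corner `suc q` is reached along edge `q`. If this edge opens a child, the child is visited
  -- there for the first time; if it closes one, as in `first-close`, the traversal is back at the
  -- vertex of corner `σ q`.
  first-open : ∀ {q} → q < σ q → firstCorner (suc q) ≡ suc q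
  first-open {q} q<σq with σ q <ᵇ q in lt
  ... | false = refl
  ... | true  = contradiction (<ᵇ⇒< (σ q) q (subst T (sym lt) tt)) (<-asym q<σq)

  first-close : ∀ {q} → σ q < q → firstCorner (suc q) ≡ firstCorner (σ q)
  first-close {q} σq<q with σ q <ᵇ q in lt
  ... | true  = firstWithin-irrelevant q (σ q) (σ q) (<⇒≤ σq<q) ≤-refl
  ... | false = ⊥-elim (subst T lt (<⇒<ᵇ σq<q))

  FirstCornerIn : ℕ → ℕ → ℕ → Set
  FirstCornerIn i k y = i < y × y < k × firstCorner y ≡ y

  -- Preorder lists the vertices as the contour discovers them, so their first corners increase; in
  -- particular they are distinct.
  first-labels : ∀ {x i F k} → Contour σ firstCorner x i F k →
    All (FirstCornerIn i k) (labels F) × AllPairs _<_ (labels F)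
  first-labels [] = [] , []
  first-labels {i = i} {k = k} (edge {j = j} {cs = cs} {ts} refl σj refl ℓj c t)
    with allc , sortc ← first-labels c | allt , sortt ← first-labels t
    rewrite first-open {i} (contour-≤ c) =
    (≤-refl , <-≤-trans (s≤s i<j) j<k , first-open i<j)
      ∷ All.++⁺ (All.map (λ (a , b , f) → <-trans ≤-refl a , <-trans b j<k , f) allc)
                (All.map (λ (a , b , f) → <-trans (<-trans i<j ≤-refl) a , b , f) allt)
    , All.++⁺ (All.map proj₁ allc) (All.map (λ (a , _ , _) → <-trans (s≤s i<j) a) allt)
      ∷ AllPairs.++⁺ sortc sortt (All.map (λ (_ , b , _) → All.map (λ (a , _ , _) → <-trans b (<-trans ≤-refl a)) allt) allc)
    where
    i<j : i < σ i
    i<j = contour-≤ c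
    j<k : σ i < k
    j<k = contour-≤ t

sumOver-mono : ∀ {X : Set} {f g : X → ℕ} → (∀ x → f x ≤ g x) → ∀ xs → sumOver f xs ≤ sumOver g xs
sumOver-mono le []       = z≤n
sumOver-mono le (x ∷ xs) = +-mono-≤ (le x) (sumOver-mono le xs)

sumOver-mono-< : ∀ {X : Set} {f g : X → ℕ} → (∀ x → f x ≤ g x) → ∀ {x xs} → x ∈ xs → f x < g x →
  sumOver f xs < sumOver g xs
sumOver-mono-< le {xs = _ ∷ xs} (here refl) lt = +-mono-<-≤ lt (sumOver-mono le xs)
sumOver-mono-< le {xs = y ∷ _}  (there x∈) lt = +-mono-≤-< (le y) (sumOver-mono-< le x∈ lt)

sumOver-1 : ∀ {X : Set} (xs : List X) → sumOver (λ _ → 1) xs ≡ length xs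
sumOver-1 []       = refl
sumOver-1 (x ∷ xs) = cong suc (sumOver-1 xs)

letter-opening : ∀ {L a} {u v : Fin L} → (a ≡ U → u Fin.< v) → (a ≡ D → v Fin.< u) → a ≡ opening (smaller-child u v)
letter-opening {a = a} {u} {v} up down with a | toℕ v <ᵇ toℕ u in lt
... | U | false = refl
... | D | true  = refl
... | U | true  = contradiction (<ᵇ⇒< (toℕ v) _ (subst T (sym lt) tt)) (<-asym (up refl))
... | D | false = ⊥-elim (subst T lt (<⇒<ᵇ (down refl)))

-- The labelled tree of a pair (σ, <).

module Recover {m} (l : Fin m → ℕ) (w : List Letter) (eps : epsList l ≡ map val w) (pos : 0 < K l)
    (half : K l ≡ 2 * sumL l) (a : Alpha l) where

  open Correspondence l w eps pos
  open Positions pos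
  open Alpha a renaming (σ to τ)
  open CompatibleOrder isOrder

  private
    L = Lsize l
    N = K l

  σ : ℕ → ℕ
  σ p = toℕ (τ (fin p))

  τ-σ : ∀ i → toℕ (τ i) ≡ σ (toℕ i)
  τ-σ i = cong (toℕ ∘ τ) (sym (fin-toℕ i))

  fin-σ : ∀ p → fin (σ p) ≡ τ (fin p)
  fin-σ p = fin-toℕ (τ (fin p))

  σ-noncrossing : NonCrossingOn σ N
  σ-noncrossing = record
    { bounded     = λ _ → toℕ<n _
    ; involutive  = λ {p} p<N → trans (cong (toℕ ∘ τ) (fin-σ p)) (trans (cong toℕ (proj₁ pairing (fin p))) (toℕ-fin p<N))
    ; fixfree     = λ {p} p<N eq → proj₂ pairing (fin p) (toℕ-injective (trans eq (sym (toℕ-fin p<N))))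
    ; noncrossing = λ {p} {q} p<q q<r r<s s<N →
        let q<N = <-trans q<r (toℕ<n _)
            p<N = <-trans p<q q<N
        in noncross (fin p , fin q , τ (fin p) , τ (fin q)
          , subst₂ _<_ (sym (toℕ-fin p<N)) (sym (toℕ-fin q<N)) p<q
          , subst (_< σ p) (sym (toℕ-fin q<N)) q<r , r<s , refl , refl) }
  open NonCrossingOn σ-noncrossing

  open FirstCorner σ

  returns : ∀ i → i < σ i → σ i < N → firstCorner (suc (σ i)) ≡ firstCorner i
  returns i i<j j<N = trans (first-close (subst (_< σ i) (sym inv) i<j)) (cong firstCorner inv)
    where
    inv : σ (σ i) ≡ i
    inv = involutive (<-trans i<j j<N)

  -- Only the contour property of the parsed forest is used below, never the way it is computed.
  abstract
    parsed : ∃ λ F → Contour σ firstCorner 0 0 F N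
    parsed = parse σ-noncrossing returns N 0 N ≤-refl z≤n (≤-reflexive (sym (+-identityʳ N))) refl
               (λ p _ p<N → z≤n , bounded p<N)

  F : Forest ℕ
  F = proj₁ parsed

  contourF : Contour σ firstCorner 0 0 F N
  contourF = proj₂ parsed

  firsts : List ℕ
  firsts = 0 ∷ labels F

  -- The contour runs along each tree edge twice and has `2 * sumL l` steps, so there are `sumL l`
  -- edges and one vertex more.
  firsts-length : length firsts ≡ L
  firsts-length = trans (cong suc (*-cancelˡ-≡ (length (labels F)) (sumL l) 2
    (trans (sym (trans (contour-endOf contourF) (endOf-labels 0 F))) half))) (+-comm 1 (sumL l))

  firsts-sorted : AllPairs _<_ firsts
  firsts-sorted = All.map proj₁ (proj₁ (first-labels contourF)) ∷ proj₂ (first-labels contourF)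

  firsts-fixed : All (λ r → r < N × firstCorner r ≡ r) firsts
  firsts-fixed = (pos , refl) ∷ All.map proj₂ (proj₁ (first-labels contourF))

  ∼⇒first : ∀ {i j} → i ∼[ τ ] j → firstCorner (toℕ i) ≡ firstCorner (toℕ j)
  ∼⇒first = glued-label τ-σ refl contourF

  ∼-firstWithin : ∀ n p → p ≤ n → p ≤ N → fin p ∼[ τ ] fin (firstWithin n p)
  ∼-firstWithin n       zero    le       p≤N = EqC.reflexive _
  ∼-firstWithin (suc n) (suc q) (s≤s le) q<N with σ q <ᵇ q in lt
  ... | false = EqC.reflexive _
  ... | true  = EqC.transitive _ back (∼-firstWithin n (σ q) (≤-trans σq≤q le) (<⇒≤ (bounded q<N)))
    where
    σq≤q : σ q ≤ q
    σq≤q = <⇒≤ (<ᵇ⇒< (σ q) q (subst T (sym lt) tt))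
    -- The gluing is taken at the opening edge `σ q`, whose partner is `q`; the corner after that
    -- partner is `suc q`.
    back : fin (suc q) ∼[ τ ] fin (σ q)
    back = EqC.symmetric _ (subst (fin (σ q) ∼[ τ ]_) (trans (next-fin (τ (fin (σ q)))) (cong (fin ∘ suc) (involutive q<N)))
      (EqC.return (glue (fin (σ q)))))

  ∼-first : ∀ i → i ∼[ τ ] fin (firstCorner (toℕ i))
  ∼-first i = subst (_∼[ τ ] fin (firstCorner (toℕ i))) (fin-toℕ i) (∼-firstWithin (toℕ i) (toℕ i) ≤-refl (<⇒≤ (toℕ<n i)))

  first∈ : ∀ i → firstCorner (toℕ {N} i) ∈ firsts
  first∈ i = contour-label refl contourF (toℕ i) z≤n (<⇒≤ (toℕ<n i))

  -- The order is an arbitrary relation, but `trichotomy` is a disjunction that can be inspected; a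
  -- decision is needed because ranks are obtained by counting.
  order? : ∀ i j → Dec (order i j)
  order? i j with trichotomy i j
  ... | inj₁ lt        = yes lt
  ... | inj₂ (inj₁ eq) = no (irrefl eq)
  ... | inj₂ (inj₂ gt) = no λ lt → irrefl (EqC.reflexive _) (transitive lt gt)

  below : Fin N → ℕ → ℕ
  below i r = ⟦ does (order? (fin r) i) ⟧

  below-yes : ∀ {i r} → order (fin r) i → below i r ≡ 1
  below-yes {i} {r} o rewrite dec-true (order? (fin r) i) o = refl

  below-no : ∀ {i r} → ¬ order (fin r) i → below i r ≡ 0
  below-no {i} {r} o rewrite dec-false (order? (fin r) i) o = refl

  below-mono : ∀ {i j} → (∀ x → order x i → order x j) → ∀ r → below i r ≤ below j r
  below-mono {i} {j} sub r with order? (fin r) i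
  ... | no _  = z≤n
  ... | yes o = ≤-reflexive (sym (below-yes (sub _ o)))

  below-self : ∀ i → below i (firstCorner (toℕ i)) ≡ 0
  below-self i = below-no (irrefl (EqC.symmetric _ (∼-first i)))

  -- Summation over first corners counts each vertex of the quotient tree exactly once.
  rankℕ : Fin N → ℕ
  rankℕ i = sumOver (below i) firsts

  rankℕ<L : ∀ i → rankℕ i < L
  rankℕ<L i = subst (rankℕ i <_) (trans (sumOver-1 firsts) firsts-length)
    -- Strictness comes from the first corner of `i` itself, which is among the `L` first corners
    -- but not below `i`.
    (sumOver-mono-< ≤1 (first∈ i) (subst (_< 1) (sym (below-self i)) ≤-refl))
    where
    ≤1 : ∀ r → below i r ≤ 1
    ≤1 r with does (order? (fin r) i)
    ... | true  = ≤-refl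
    ... | false = z≤n

  rank : Fin N → Fin L
  rank i = fromℕ< (rankℕ<L i)

  rank-mono : ∀ i j → order i j → rank i Fin.< rank j
  rank-mono i j o = subst₂ _<_ (sym (toℕ-fromℕ< (rankℕ<L i))) (sym (toℕ-fromℕ< (rankℕ<L j)))
    (sumOver-mono-< (below-mono (λ _ p → transitive p o)) (first∈ i)
      (subst₂ _<_ (sym (below-self i)) (sym (below-yes (respects (∼-first i) (EqC.reflexive _) o))) ≤-refl))

  rank-cong : ∀ {i j} → i ∼[ τ ] j → rank i ≡ rank j
  rank-cong {i} {j} eq = toℕ-injective (trans (toℕ-fromℕ< (rankℕ<L i))
    (trans (≤-antisym (sumOver-mono (below-mono λ _ → respects (EqC.reflexive _) eq) firsts)
                      (sumOver-mono (below-mono λ _ → respects (EqC.reflexive _) (EqC.symmetric _ eq)) firsts))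
      (sym (toℕ-fromℕ< (rankℕ<L j)))))

  rank-order : ∀ i j → rank i Fin.< rank j → order i j
  rank-order i j lt = compare (trichotomy i j)
    where
    compare : order i j ⊎ (i ∼[ τ ] j) ⊎ order j i → order i j
    compare (inj₁ o)         = o
    compare (inj₂ (inj₁ eq)) = contradiction (cong toℕ (rank-cong eq)) (<⇒≢ lt)
    compare (inj₂ (inj₂ o))  = contradiction (rank-mono j i o) (<-asym lt)

  rank-injective : ∀ i j → rank i ≡ rank j → i ∼[ τ ] j
  rank-injective i j eq = compare (trichotomy i j)
    where
    compare : order i j ⊎ (i ∼[ τ ] j) ⊎ order j i → i ∼[ τ ] j
    compare (inj₁ o)        = contradiction (cong toℕ eq) (<⇒≢ (rank-mono i j o))
    compare (inj₂ (inj₁ p)) = p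
    compare (inj₂ (inj₂ o)) = contradiction (cong toℕ eq) (>⇒≢ (rank-mono j i o))

  label : ℕ → Fin L
  label = rank ∘ fin

  x : Fin L
  x = label 0

  cs : Forest (Fin L)
  cs = relabel label F

  ℓ : ℕ → Fin L
  ℓ = label ∘ firstCorner

  ℓ-rank : ∀ i → ℓ (toℕ i) ≡ rank i
  ℓ-rank i = rank-cong (EqC.symmetric _ (∼-first i))

  contour : Contour σ ℓ x 0 cs N
  contour = contour-relabel label contourF

  wraps : ℓ N ≡ ℓ 0
  wraps = contour-end refl contour

  labels-unique : Unique (x ∷ labels cs)
  labels-unique = subst (Unique ∘ (x ∷_)) (sym (labels-relabel label F)) (distinct firsts firsts-sorted firsts-fixed)
    where
    label-injective : ∀ {r r′} → r < N × firstCorner r ≡ r → r′ < N × firstCorner r′ ≡ r′ → label r ≡ label r′ → r ≡ r′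
    label-injective {r} {r′} (r<N , fr) (r′<N , fr′) eq = begin
      r                            ≡⟨ fr ⟨
      firstCorner r                ≡⟨ cong firstCorner (toℕ-fin r<N) ⟨
      firstCorner (toℕ (fin r))    ≡⟨ ∼⇒first (rank-injective (fin r) (fin r′) eq) ⟩
      firstCorner (toℕ (fin r′))   ≡⟨ cong firstCorner (toℕ-fin r′<N) ⟩
      firstCorner r′               ≡⟨ fr′ ⟩
      r′                           ∎
      where open ≡-Reasoning
    distinct : ∀ rs → AllPairs _<_ rs → All (λ r → r < N × firstCorner r ≡ r) rs → Unique (map label rs)
    distinct []       []       []       = []
    distinct (r ∷ rs) (lt ∷ s) (f ∷ fs) =
      All.map⁺ (All.zipWith (λ (lt′ , f′) eq → <⇒≢ lt′ (label-injective f f′ eq)) (lt , fs)) ∷ distinct rs s fs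

  once : Once x cs
  once z = trans (cong (δ z x +_) (countF-labels z cs)) (≤-antisym
    (unique⇒occurrences (x ∷ labels cs) labels-unique z)
    (∈⇒occurrences (unique-full (x ∷ labels cs) labels-unique
      (trans (cong (suc ∘ length) (labels-relabel label F)) (trans (cong suc (length-map label (labels F))) firsts-length)) z)))

  up-step : ∀ i → e (toℕ i) ≡ U → ℓ (toℕ i) Fin.< ℓ (suc (toℕ i))
  up-step i eq = subst₂ Fin._<_ (sym (ℓ-rank i)) (trans (sym (ℓ-rank (next i))) (at-next ℓ wraps i))
    (rank-mono i (next i) (compatible [ _ , _ , EqC.reflexive _ , plusE i (trans (εm-val i) (cong val eq)) , EqC.reflexive _ ]))

  down-step : ∀ i → e (toℕ i) ≡ D → ℓ (suc (toℕ i)) Fin.< ℓ (toℕ i)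
  down-step i eq = subst₂ Fin._<_ (trans (sym (ℓ-rank (next i))) (at-next ℓ wraps i)) (sym (ℓ-rank i))
    (rank-mono (next i) i (compatible [ _ , _ , EqC.reflexive _ , minusE i (trans (εm-val i) (cong val eq)) , EqC.reflexive _ ]))

  opens : ∀ i → e (toℕ i) ≡ opening (smaller-child (ℓ (toℕ i)) (ℓ (suc (toℕ i))))
  opens i = letter-opening (up-step i) (down-step i)

  val-0 : ∀ a b → val a ℤ.+ val b ≡ 0ℤ → b ≡ op a
  val-0 U D _ = refl
  val-0 D U _ = refl

  reads : wordF smaller-child (smaller-child x) cs [] ≡ w
  reads = agrees-unique 0 _ w
    (trans (trans (length-wordF smaller-child (smaller-child x) cs [] 0) (+-identityʳ _))
      (trans (sym (contour-endOf contour)) (sym length-w)))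
    (contour-word smaller-child refl contour
      (λ p _ p<N → subst (λ q → e q ≡ opening (smaller-child (ℓ q) (ℓ (suc q)))) (toℕ-fin p<N) (opens (fin p)))
      (λ p _ p<N → trans (val-0 (e (toℕ (fin p))) _ (trans (sym (cong₂ ℤ._+_ (εm-val (fin p)) (εm-val (τ (fin p))))) (compat (fin p))))
        (cong (op ∘ e) (toℕ-fin p<N)))
      tt)
    (agrees-nth U w)

  corresponds : Corresponds a x cs
  corresponds = record
    { σ = σ ; ℓ = ℓ ; pairs = τ-σ
    ; orders = λ i j → mk⇔ (λ o → subst₂ Fin._<_ (sym (ℓ-rank i)) (sym (ℓ-rank j)) (rank-mono i j o))
                           (λ lt → rank-order i j (subst₂ Fin._<_ (ℓ-rank i) (ℓ-rank j) lt))
    ; root = refl ; contour = contour ; reads = reads ; once = once }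

-- The word ε_m

alternate : Letter → List ℕ → List Letter
alternate a []       = []
alternate a (n ∷ ns) = replicate n a ++ alternate (op a) ns

-- `applyUpTo` recurses by shifting its function, so the induction is over all `f` with successive
-- values; `f` is the identity in the end.
signs : ∀ ns (f : ℕ → ℕ) a → (∀ i → f (suc i) ≡ suc (f i)) → -1ℤ ℤ.^ f 0 ≡ val a →
  concat (map (λ (r , n) → replicate n (-1ℤ ℤ.^ r)) (zip (applyUpTo f (length ns)) ns)) ≡ map val (alternate a ns)
signs []       f a suc-f eq = refl
signs (n ∷ ns) f a suc-f eq = trans
  (cong₂ _++_ (trans (cong (replicate n) eq) (sym (map-replicate val n a)))
    (signs ns (f ∘ suc) (op a) (suc-f ∘ suc) (trans (cong (-1ℤ ℤ.^_) (suc-f 0)) (trans (cong (-1ℤ ℤ.*_) eq) (negate a)))))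
  (sym (map-++ val (replicate n a) (alternate (op a) ns)))
  where
  negate : ∀ a → -1ℤ ℤ.* val a ≡ val (op a)
  negate U = refl
  negate D = refl

epsList-alternate : ∀ {m} (l : Fin m → ℕ) → epsList l ≡ map val (alternate U (blockLengths l))
epsList-alternate {m} l = trans
  (cong concat (map-cong (λ (r , n) → refl) (zip (upTo (2 * m)) (blockLengths l))))
  (trans (cong (λ k → concat (map (λ (r , n) → replicate n (-1ℤ ℤ.^ r)) (zip (upTo k) (blockLengths l)))) (sym blocks))
    (signs (blockLengths l) id U (λ _ → refl) refl))
  where
  len : length (map l (allFin m)) ≡ m
  len = trans (length-map l (allFin m)) (length-tabulate id)
  blocks : length (blockLengths l) ≡ 2 * m
  blocks = trans (length-++ (reverse (map l (allFin m))))
    (cong₂ _+_ (trans (length-reverse (map l (allFin m))) len) (trans len (sym (+-identityʳ m))))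

alternate-op : ∀ a ns → alternate (op a) ns ≡ map op (alternate a ns)
alternate-op a []       = refl
alternate-op a (n ∷ ns) = sym (trans (map-++ op (replicate n a) _)
  (cong₂ _++_ (map-replicate op n a) (sym (alternate-op (op a) ns))))

flips : ℕ → Letter → Letter
flips zero    a = a
flips (suc n) a = flips n (op a)

flips-double : ∀ n a → flips (n + n) a ≡ a
flips-double zero    a = refl
flips-double (suc n) a rewrite +-suc n n | op-involutive a = flips-double n a

alternate-++ : ∀ a xs ys → alternate a (xs ++ ys) ≡ alternate a xs ++ alternate (flips (length xs) a) ys
alternate-++ a []       ys = refl
alternate-++ a (n ∷ xs) ys = trans (cong (replicate n a ++_) (alternate-++ (op a) xs ys))
  (sym (++-assoc (replicate n a) (alternate (op a) xs) _))

-- Between the two outermost blocks there are evenly many blocks, and the first of them has sign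
-- `D`; therefore the last outer block has sign `D` too.
alternate-palindrome : ∀ {J : Set} (js : List (ℕ × J)) →
  alternate U (map proj₁ js ++ reverse (map proj₁ js)) ≡ stagesWord js
alternate-palindrome []             = refl
alternate-palindrome ((n , _) ∷ js) = cong (replicate n U ++_) (begin
  alternate D (ns ++ reverse (n ∷ ns))              ≡⟨ cong (λ v → alternate D (ns ++ v)) (unfold-reverse n ns) ⟩
  alternate D (ns ++ (reverse ns ∷ʳ n))             ≡⟨ cong (alternate D) (++-assoc ns (reverse ns) _) ⟨
  alternate D ((ns ++ reverse ns) ∷ʳ n)             ≡⟨ alternate-++ D (ns ++ reverse ns) (n ∷ []) ⟩
  alternate D (ns ++ reverse ns) ++ alternate (flips (length (ns ++ reverse ns)) D) (n ∷ [])
    ≡⟨ cong₂ (λ v a → v ++ alternate a (n ∷ [])) (alternate-op U (ns ++ reverse ns)) even ⟩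
  map op (alternate U (ns ++ reverse ns)) ++ (replicate n D ++ [])
    ≡⟨ cong₂ (λ v v′ → map op v ++ v′) (alternate-palindrome js) (++-identityʳ (replicate n D)) ⟩
  map op (stagesWord js) ++ replicate n D           ∎)
  where
  open ≡-Reasoning
  ns = map proj₁ js
  even : flips (length (ns ++ reverse ns)) D ≡ D
  even = trans (cong (λ k → flips k D) (trans (length-++ ns) (cong (length ns +_) (length-reverse ns))))
    (flips-double (length ns) D)

stagesWord-length : ∀ {J : Set} (js : List (ℕ × J)) → length (stagesWord js) ≡ 2 * sumOver proj₁ js
stagesWord-length []             = refl
stagesWord-length ((n , _) ∷ js) rewrite length-++ (replicate n U) {map op (stagesWord js) ++ replicate n D}
  | length-++ (map op (stagesWord js)) {replicate n D} | length-map op (stagesWord js)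
  | length-replicate n {U} | length-replicate n {D} | stagesWord-length js =
  solve 2 (λ n s → n :+ (con 2 :* s :+ n) := con 2 :* (n :+ s)) refl n (sumOver proj₁ js)

-- Indices of the blocks, largest first

highToLow : ∀ {m} n → .(n ≤ m) → List (Fin m)
highToLow zero    _ = []
highToLow (suc n) p = fromℕ< p ∷ highToLow n (<⇒≤ p)

highToLow-toℕ : ∀ {m} n .(p : n ≤ m) → map toℕ (highToLow n p) ≡ downFrom n
highToLow-toℕ zero    p = refl
highToLow-toℕ (suc n) p = cong₂ _∷_ (toℕ-fromℕ< p) (highToLow-toℕ n (<⇒≤ p))

tabulate-toℕ : ∀ {A : Set} n (f : ℕ → A) → tabulate {n = n} (f ∘ toℕ) ≡ applyUpTo f n
tabulate-toℕ zero    f = refl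
tabulate-toℕ (suc n) f = cong (f 0 ∷_) (tabulate-toℕ n (f ∘ suc))

highToLow-reverse : ∀ m → highToLow m ≤-refl ≡ reverse (allFin m)
highToLow-reverse m = map-injective toℕ-injective (begin
  map toℕ (highToLow m ≤-refl)   ≡⟨ highToLow-toℕ m ≤-refl ⟩
  downFrom m                     ≡⟨ reverse-upTo m ⟨
  reverse (upTo m)               ≡⟨ cong reverse (trans (map-tabulate id toℕ) (tabulate-toℕ m id)) ⟨
  reverse (map toℕ (allFin m))   ≡⟨ reverse-map toℕ (allFin m) ⟨
  map toℕ (reverse (allFin m))   ∎)
  where open ≡-Reasoning

sumOver-highToLow : ∀ {m} (f : Fin m → ℕ) → sumOver f (highToLow m ≤-refl) ≡ sumOver f (allFin m)
sumOver-highToLow {m} f = trans (cong (sumOver f) (highToLow-reverse m)) (sumOver-reverse f (allFin m))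

sum-map : ∀ {X : Set} (f : X → ℕ) xs → sum (map f xs) ≡ sumOver f xs
sum-map f []       = refl
sum-map f (x ∷ xs) = cong (f x +_) (sum-map f xs)

sumOver-map : ∀ {X Y : Set} (f : Y → ℕ) (g : X → Y) xs → sumOver f (map g xs) ≡ sumOver (f ∘ g) xs
sumOver-map f g []       = refl
sumOver-map f g (x ∷ xs) = cong (f (g x) +_) (sumOver-map f g xs)

sumOver-cong : ∀ {X : Set} {f g : X → ℕ} → (∀ x → f x ≡ g x) → ∀ xs → sumOver f xs ≡ sumOver g xs
sumOver-cong eq []       = refl
sumOver-cong eq (x ∷ xs) = cong₂ _+_ (eq x) (sumOver-cong eq xs)

sumOver-filter : ∀ {X : Set} {P : X → Set} (P? : Decidable P) (f : X → ℕ) xs →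
  sum (map f (filter P? xs)) ≡ sumOver (λ x → if does (P? x) then f x else 0) xs
sumOver-filter P? f []       = refl
sumOver-filter P? f (x ∷ xs) with does (P? x)
... | true  = cong (f x +_) (sumOver-filter P? f xs)
... | false = sumOver-filter P? f xs

sumBelow-highToLow : ∀ {m} (f : Fin m → ℕ) n (p : n ≤ m) → sumBelow f n ≡ sumOver f (highToLow n p)
sumBelow-highToLow {m} f n p = begin
  sumBelow f n                     ≡⟨ sumOver-filter (λ j → toℕ j <? n) f (allFin m) ⟩
  sumOver below (allFin m)         ≡⟨ sumOver-highToLow below ⟨
  sumOver below (highToLow m ≤-refl) ≡⟨ beyond m ≤-refl p ⟩
  sumOver below (highToLow n p)    ≡⟨ within n p ≤-refl ⟩
  sumOver f (highToLow n p)        ∎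
  where
  open ≡-Reasoning
  below : Fin m → ℕ
  below j = if does (toℕ j <? n) then f j else 0
  within : ∀ k (q : k ≤ m) → k ≤ n → sumOver below (highToLow k q) ≡ sumOver f (highToLow k q)
  within zero    q le = refl
  within (suc k) q le rewrite toℕ-fromℕ< q | dec-true (k <? n) le = cong (f (fromℕ< q) +_) (within k (<⇒≤ q) (<⇒≤ le))
  beyond : ∀ k (q : k ≤ m) → n ≤ k → sumOver below (highToLow k q) ≡ sumOver below (highToLow n p)
  beyond k q le with m≤n⇒m<n∨m≡n le
  ... | inj₂ refl = refl
  beyond (suc k) q le | inj₁ (s≤s n≤k) rewrite toℕ-fromℕ< q | dec-false (k <? n) (≤⇒≯ n≤k) = beyond k (<⇒≤ q) n≤k

-- The labels in increasing order as a schedule.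

allFin-complete : ∀ {n} → Complete (allFin n)
allFin-complete {suc n} Fin.zero    = cong suc (none n Fin.suc {Fin.zero} λ _ ())
  where
  none : ∀ {k} n (f : Fin n → Fin k) {z} → (∀ i → z ≢ f i) → occurrences z (tabulate f) ≡ 0
  none zero    f ne = refl
  none (suc n) f ne rewrite δ-≢ (ne Fin.zero) = none n (f ∘ Fin.suc) (ne ∘ Fin.suc)
allFin-complete {suc n} (Fin.suc z) = trans (shift n id) (allFin-complete {n} z)
  where
  shift : ∀ k (f : Fin k → Fin n) → occurrences (Fin.suc z) (tabulate (Fin.suc ∘ f)) ≡ occurrences z (tabulate f)
  shift zero    f = refl
  shift (suc k) f = cong₂ _+_ refl (shift k (f ∘ Fin.suc))

-- The extra vertex stands immediately in front of the label `off`: the labels passed are those less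
-- than `off`, and `f` enumerates the others.
schedule-up : ∀ {L} n off (f : Fin n → Fin L) → (∀ i → toℕ (f i) ≡ off + toℕ i) → off + n ≡ L →
  Schedule smaller-child (λ z → toℕ z <ᵇ off) (tabulate f)
schedule-up {L} zero    off f eq len = done λ z →
  <⇒<ᵇ-true (<-≤-trans (toℕ<n z) (≤-reflexive (trans (sym len) (+-identityʳ off))))
  where
  <⇒<ᵇ-true : ∀ {a b} → a < b → (a <ᵇ b) ≡ true
  <⇒<ᵇ-true {a} {b} lt = dec-true (a <? b) lt
schedule-up {L} (suc n) off f eq len = pass (record
  { threshold = λ z _ → cong (toℕ z <ᵇ_) (sym f0)
  ; above     = dec-false (toℕ (f Fin.zero) <? off) (λ lt → <-irrefl f0 lt)
  ; others    = λ z z≢ → agree (toℕ z) off (λ e → z≢ (toℕ-injective (trans e (sym f0))))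
  ; below     = dec-true (toℕ (f Fin.zero) <? suc off) (s≤s (≤-reflexive f0)) })
  (schedule-up n (suc off) (f ∘ Fin.suc) (λ i → trans (eq (Fin.suc i)) (+-suc off (toℕ i))) (trans (sym (+-suc off n)) len))
  where
  f0 : toℕ (f Fin.zero) ≡ off
  f0 = trans (eq Fin.zero) (+-identityʳ off)
  agree : ∀ a b → a ≢ b → (a <ᵇ b) ≡ (a <ᵇ suc b)
  agree zero    zero    ne = contradiction refl ne
  agree zero    (suc b) ne = refl
  agree (suc a) zero    ne = refl
  agree (suc a) (suc b) ne = agree a b (ne ∘ cong suc)

schedule-allFin : ∀ L → Schedule {L} smaller-child (const false) (allFin L)
schedule-allFin L = schedule-cong (λ _ → refl) (schedule-up L 0 id (λ _ → refl) refl)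

-- Cardinalities, double counting and budgets.

sumOver-tabulate : ∀ {n} {X : Set} (f : X → ℕ) (g : Fin n → X) (p : Subset n) →
  (∀ i → f (g i) ≡ ⟦ Vec.lookup p i ⟧) → sumOver f (tabulate g) ≡ ∣ p ∣
sumOver-tabulate f g []          eq = refl
sumOver-tabulate f g (true ∷ p)  eq = cong₂ _+_ (eq Fin.zero) (sumOver-tabulate f (g ∘ Fin.suc) p (eq ∘ Fin.suc))
sumOver-tabulate f g (false ∷ p) eq = cong₂ _+_ (eq Fin.zero) (sumOver-tabulate f (g ∘ Fin.suc) p (eq ∘ Fin.suc))

sumOver-+ : ∀ {X : Set} (f g : X → ℕ) xs → sumOver (λ x → f x + g x) xs ≡ sumOver f xs + sumOver g xs
sumOver-+ f g []       = refl
sumOver-+ f g (x ∷ xs) rewrite sumOver-+ f g xs =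
  solve 4 (λ a b c d → a :+ b :+ (c :+ d) := a :+ c :+ (b :+ d)) refl (f x) (g x) (sumOver f xs) (sumOver g xs)

sumOver-swap : ∀ {X Y : Set} (f : X → Y → ℕ) xs ys →
  sumOver (λ x → sumOver (f x) ys) xs ≡ sumOver (λ y → sumOver (λ x → f x y) xs) ys
sumOver-swap f []       ys = sym (zeros ys)
  where
  zeros : ∀ ys → sumOver (λ _ → 0) ys ≡ 0
  zeros []       = refl
  zeros (_ ∷ ys) = zeros ys
sumOver-swap f (x ∷ xs) ys = trans (cong (sumOver (f x) ys +_) (sumOver-swap f xs ys)) (sym (sumOver-+ (f x) _ ys))

term-≤ : ∀ {X : Set} (h : X → ℕ) {x xs} → x ∈ xs → h x ≤ sumOver h xs
term-≤ h (here refl)              = m≤m+n _ _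
term-≤ h {xs = y ∷ _} (there x∈) = ≤-trans (term-≤ h x∈) (m≤n+m _ (h y))

two-terms-≤ : ∀ {X : Set} (h : X → ℕ) {x y xs} → x ≢ y → x ∈ xs → y ∈ xs → h x + h y ≤ sumOver h xs
two-terms-≤ h x≢y (here refl) (here refl) = contradiction refl x≢y
two-terms-≤ h {x} x≢y (here refl) (there y∈)  = +-monoʳ-≤ (h x) (term-≤ h y∈)
two-terms-≤ h {x} {y} x≢y (there x∈) (here refl) = ≤-trans (≤-reflexive (+-comm (h x) (h y))) (+-monoʳ-≤ (h y) (term-≤ h x∈))
two-terms-≤ h {xs = z ∷ _} x≢y (there x∈) (there y∈) = ≤-trans (two-terms-≤ h x≢y x∈ y∈) (m≤n+m _ (h z))

positive-term : ∀ {X : Set} (h : X → ℕ) xs → 1 ≤ sumOver h xs → ∃ λ x → 1 ≤ h x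
positive-term h (x ∷ xs) le with h x in eq
... | suc _ = x , subst (1 ≤_) (sym eq) (s≤s z≤n)
... | zero  = positive-term h xs le

at-most-one : ∀ {X : Set} (φ : X → Bool) xs → Unique xs → (∀ x y → x ≢ y → φ x ≡ true → φ y ≡ true → ⊥) →
  sumOver (⟦_⟧ ∘ φ) xs ≤ 1
at-most-one φ []       u        ex = z≤n
at-most-one φ (x ∷ xs) (x∉ ∷ u) ex with φ x in eq
... | false = at-most-one φ xs u ex
... | true  = s≤s (none xs x∉)
  where
  none : ∀ ys → All (x ≢_) ys → sumOver (⟦_⟧ ∘ φ) ys ≤ 0
  none []       []        = z≤n
  none (y ∷ ys) (ne ∷ a) with φ y in eq′
  ... | false = none ys a
  ... | true  = ⊥-elim (ex x y ne eq eq′)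

-- With no free `U`, the initial `U` belongs to a tree. The `D` closing that tree is read one level
-- below the start of `w`, which stays at or above that level; hence it is the final `D` and nothing
-- follows the tree.
single-tree : ∀ {A : Set} (c : A → A → Bool) w s → Dyck 0 w → ups s ≡ 0 →
  word c (const false) s ≡ U ∷ (w ++ D ∷ []) → ∃₂ λ x cs → s ≡ tr (node x cs) ∷ [] × wordF c (c x) cs [] ≡ w
single-tree c w (ltr U ∷ s) dy () eq
single-tree c w (ltr D ∷ s) dy none ()
single-tree c w (tr (node x cs) ∷ rest) dy none eq = x , cs , cong (tr (node x cs) ∷_) (empty rest (∷-injectiveʳ eq))
  , ∷ʳ-injectiveˡ _ w (trans (sym (wordF-++ c (c x) cs [] (D ∷ [])))
      (subst (λ r → wordF c (c x) cs (D ∷ word c (const false) r) ≡ w ∷ʳ D) (empty rest (∷-injectiveʳ eq)) (∷-injectiveʳ eq)))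
  where
  ends : ∀ v → v ≢ [] → wordF c (c x) cs (D ∷ v) ≢ w ∷ʳ D
  ends v v≢[] eq with initLast v
  ... | []       = v≢[] refl
  ... | v′ ∷ʳ′ a = dyck-wordF c (c x) cs (D ∷ v′) {0} (subst (Dyck 0)
    (sym (∷ʳ-injectiveˡ _ w (trans (sym (wordF-++ c (c x) cs (D ∷ v′) (a ∷ []))) eq))) dy)
  empty : ∀ rest → wordF c (c x) cs (D ∷ word c (const false) rest) ≡ w ∷ʳ D → rest ≡ []
  empty []                    eq = refl
  empty (ltr a ∷ rest)        eq = contradiction eq (ends _ λ ())
  empty (tr (node _ _) ∷ rest) eq = contradiction eq (ends _ λ ())

-- The balances telescope, the last excess being 0.
budget-sum : ∀ {L m} (b : Fin m → ℕ) u (js : Stages {L} {m}) → Budget {L} b u js →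
  sumOver (b ∘ proj₂) js + u ≡ sumOver proj₁ js
budget-sum b u []             bd = bd
budget-sum {L} b u ((n , j) ∷ js) (u′ , bal , bd) = begin
  b j + B + u    ≡⟨ solve 3 (λ a c e → a :+ c :+ e := c :+ (a :+ e)) refl (b j) B u ⟩
  B + (b j + u)  ≡⟨ cong (B +_) bal ⟩
  B + (n + u′)   ≡⟨ solve 3 (λ a c e → a :+ (c :+ e) := c :+ (a :+ e)) refl B n u′ ⟩
  n + (B + u′)   ≡⟨ cong (n +_) (budget-sum {L} b u′ js bd) ⟩
  n + sumOver proj₁ js ∎
  where
  open ≡-Reasoning
  B = sumOver (b ∘ proj₂) js

replicate-∷ʳ : ∀ {A : Set} n (a : A) → replicate (suc n) a ≡ replicate n a ∷ʳ a
replicate-∷ʳ zero    a = refl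
replicate-∷ʳ (suc n) a = cong (a ∷_) (replicate-∷ʳ n a)

-- The bijection.

module Assembly {m′ : ℕ} (l : Fin (suc m′) → ℕ) (l≥1 : ∀ i → 1 ≤ l i) (mono : ∀ i j → i Fin.≤ j → l i ≤ l j) where

  private
    m = suc m′
    L = Lsize l

  indexed : List (Fin m) → List (ℕ × Fin m)
  indexed = map (λ j → l j , j)

  top : Fin m
  top = fromℕ< (≤-refl {m})

  w : List Letter
  w = stagesWord (indexed (highToLow m ≤-refl))

  -- The edge above the root accounts for the additional U and D.
  stages : List (ℕ × Fin m)
  stages = (suc (l top) , top) ∷ indexed (highToLow m′ (n≤1+n m′))

  eps : epsList l ≡ map val w
  eps = trans (epsList-alternate l) (cong (map val) (trans (cong (alternate U) blocks) (alternate-palindrome (indexed hl))))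
    where
    hl = highToLow m ≤-refl
    rev : map proj₁ (indexed hl) ≡ reverse (map l (allFin m))
    rev = trans (sym (map-∘ hl)) (trans (cong (map l) (highToLow-reverse m)) (reverse-map l (allFin m)))
    blocks : blockLengths l ≡ map proj₁ (indexed hl) ++ reverse (map proj₁ (indexed hl))
    blocks = sym (cong₂ _++_ rev (trans (cong reverse rev) (reverse-involutive (map l (allFin m)))))

  sumL-highToLow : sumL l ≡ sumOver l (highToLow m ≤-refl)
  sumL-highToLow = trans (sum-map l (allFin m)) (sym (sumOver-highToLow l))

  half : K l ≡ 2 * sumL l
  half = trans (cong length eps) (trans (length-map val w) (trans (stagesWord-length (indexed (highToLow m ≤-refl)))
    (cong (2 *_) (trans (sumOver-map proj₁ _ (highToLow m ≤-refl)) (sym sumL-highToLow)))))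

  pos : 0 < K l
  pos = subst (0 <_) (sym half) (≤-trans (≤-trans (l≥1 top) (≤-trans (m≤m+n _ _) (≤-reflexive (sym sumL-highToLow))))
    (m≤m+n (sumL l) _))

  open Correspondence l w eps pos

  stages-word : stagesWord stages ≡ U ∷ (w ++ D ∷ [])
  stages-word = cong (U ∷_) (begin
    us ++ (inner ++ replicate (suc (l top)) D)  ≡⟨ cong (λ v → us ++ (inner ++ v)) (replicate-∷ʳ (l top) D) ⟩
    us ++ (inner ++ (ds ∷ʳ D))                  ≡⟨ cong (us ++_) (++-assoc inner ds _) ⟨
    us ++ ((inner ++ ds) ∷ʳ D)                  ≡⟨ ++-assoc us (inner ++ ds) _ ⟨
    w ∷ʳ D                                      ∎)
    where
    open ≡-Reasoning
    us = replicate (l top) U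
    ds = replicate (l top) D
    inner = map op (stagesWord (indexed (highToLow m′ (n≤1+n m′))))

  indexed-descending : ∀ n (p : n ≤ m) b → (∀ j → toℕ j < n → l j ≤ b) → Descending b (indexed (highToLow n p))
  indexed-descending zero    p b le = tt
  indexed-descending (suc n) p b le = le (fromℕ< p) (≤-reflexive (cong suc (toℕ-fromℕ< p)))
    , indexed-descending n (<⇒≤ p) (l (fromℕ< p))
        (λ j j<n → mono j (fromℕ< p) (≤-trans (<⇒≤ j<n) (≤-reflexive (sym (toℕ-fromℕ< p)))))

  l≤top : ∀ j → l j ≤ l top
  l≤top j = mono j top (≤-trans (≤-pred (toℕ<n j)) (≤-reflexive (sym (toℕ-fromℕ< (≤-refl {m})))))

  descending : Descending (suc (l top)) stages
  descending = ≤-refl , indexed-descending m′ (n≤1+n m′) _ (λ j _ → ≤-trans (l≤top j) (n≤1+n _))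

  w-dyck : Dyck 0 w
  w-dyck = stages-dyck (indexed (highToLow m ≤-refl)) (indexed-descending m ≤-refl (l top) (λ j _ → l≤top j))

  stages-indices : map proj₂ stages ≡ highToLow m ≤-refl
  stages-indices = cong (top ∷_) (trans (sym (map-∘ hl)) (map-id hl))
    where hl = highToLow m′ (n≤1+n m′)

  indices-complete : ∀ j → occurrences j (map proj₂ stages) ≡ 1
  indices-complete j = trans (cong (occurrences j) stages-indices) (trans (sumOver-highToLow (δ j)) (allFin-complete j))

  index∈ : ∀ j → j ∈ map proj₂ stages
  index∈ j = occurrences⇒∈ _ (≤-reflexive (sym (indices-complete j)))

  over-stages : ∀ (f : Fin m → ℕ) → sumOver (f ∘ proj₂) stages ≡ sumOver f (allFin m)
  over-stages f = trans (sym (sumOver-map f proj₂ stages)) (trans (cong (sumOver f) stages-indices) (sumOver-highToLow f))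

  member : Beta l → Fin m → Fin L → Bool
  member b j = Vec.lookup (Beta.B b j)

  member-card : ∀ b j → cardinality (member b j) (allFin L) ≡ ∣ Beta.B b j ∣
  member-card b j = sumOver-tabulate _ id (Beta.B b j) (λ _ → refl)

  -- The bijection as a relation: a run of the tree of `a` in which stage `j` releases the labels of
  -- `B j`. Existence on either side is `to-beta` and `from-beta`, uniqueness is `linked-det` and
  -- `linked-codet`.
  Linked : Alpha l → Beta l → Set
  Linked a b = ∃₂ λ x cs → Corresponds a x cs × Run (member b) (allFin L) stages (tr (node x cs) ∷ [])

  linked-det : ∀ {a a′ b b′} → a ≈α a′ → Linked a b → Linked a′ b′ → b ≈β b′
  linked-det {b = b} {b′} eq (x , cs , c , r) (x′ , cs′ , c′ , r′) j with refl ← corresponds-det eq c c′ =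
    trans (sym (Vec.tabulate∘lookup (Beta.B b j)))
      (trans (Vec.tabulate-cong (λ y → run-det r r′ (index∈ j) (occurrences⇒∈ _ (≤-reflexive (sym (allFin-complete y))))))
        (Vec.tabulate∘lookup (Beta.B b′ j)))

  linked-codet : ∀ {a a′ b b′} → b ≈β b′ → Linked a b → Linked a′ b′ → a ≈α a′
  linked-codet eq (x , cs , c , r) (x′ , cs′ , c′ , r′)
    with refl ← run-codet (λ j y → cong (λ p → Vec.lookup p y) (eq j)) r r′ = corresponds-codet c c′

  -- The stages of the lowest `k` blocks again form a budget, and in its sum the excess is a natural
  -- number.
  highToLow-sum-bound : ∀ (b : Fin m → ℕ) u n (p : n ≤ m) → Budget {L} b u (indexed (highToLow n p)) →
    ∀ k (q : k ≤ m) → k ≤ n → sumOver b (highToLow k q) ≤ sumOver l (highToLow k q)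
  highToLow-sum-bound b u n p bd k q k≤n with m≤n⇒m<n∨m≡n k≤n
  ... | inj₂ refl = ≤-trans (m≤m+n _ u) (≤-reflexive (begin
    sumOver b (highToLow n p) + u                    ≡⟨ cong (_+ u) (sumOver-map (b ∘ proj₂) _ (highToLow n p)) ⟨
    sumOver (b ∘ proj₂) (indexed (highToLow n p)) + u ≡⟨ budget-sum {L} b u (indexed (highToLow n p)) bd ⟩
    sumOver proj₁ (indexed (highToLow n p))          ≡⟨ sumOver-map proj₁ _ (highToLow n p) ⟩
    sumOver l (highToLow n p)                        ∎))
    where open ≡-Reasoning
  highToLow-sum-bound b u (suc n) p (u′ , _ , bd) k q k≤n | inj₁ (s≤s k≤n′) =
    highToLow-sum-bound b u′ n (<⇒≤ p) bd k q k≤n′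

  budget-exists : ∀ (b : Fin m → ℕ) u n (p : n ≤ m) →
    (∀ k (q : k ≤ m) → k < n → sumOver b (highToLow k q) ≤ sumOver l (highToLow k q)) →
    sumOver b (highToLow n p) + u ≡ sumOver l (highToLow n p) → Budget {L} b u (indexed (highToLow n p))
  budget-exists b u zero    p le eq = eq
  budget-exists b u (suc n) p le eq = u′ , +-cancelˡ-≡ B _ _ (begin
      B + (b j + u)    ≡⟨ solve 3 (λ a c e → c :+ (a :+ e) := a :+ c :+ e) refl (b j) B u ⟩
      b j + B + u      ≡⟨ eq ⟩
      l j + N          ≡⟨ cong (l j +_) N≡ ⟨
      l j + (B + u′)   ≡⟨ solve 3 (λ a c e → c :+ (a :+ e) := a :+ (c :+ e)) refl B (l j) u′ ⟩
      B + (l j + u′)   ∎)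
    , budget-exists b u′ n (<⇒≤ p) (λ k q k<n → le k q (<-trans k<n ≤-refl)) N≡
    where
    open ≡-Reasoning
    j = fromℕ< p
    B = sumOver b (highToLow n (<⇒≤ p))
    N = sumOver l (highToLow n (<⇒≤ p))
    -- The value forced by `budget-sum` on the remaining blocks; the inequality for `n` makes the
    -- subtraction exact.
    u′ = N ∸ B
    N≡ : B + u′ ≡ N
    N≡ = m+[n∸m]≡n (le n (<⇒≤ p) ≤-refl)

  to-beta : ∀ a → ∃ λ b → Linked a b
  to-beta a = beta , x , cs , corr , run-cong (λ {j} _ y → sym (Vec.lookup∘tabulate (φ j) y)) run
    where
    open Recover l w eps pos half a using (x; cs) renaming (corresponds to corr)
    open Corresponds corr using (reads; once)
    s₀ : State (Fin L)
    s₀ = tr (node x cs) ∷ []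
    word₀ : word smaller-child (const false) s₀ ≡ stagesWord stages
    word₀ = trans (cong (U ∷_) (trans (wordF-++ smaller-child (smaller-child x) cs [] (D ∷ [])) (cong (_∷ʳ D) reads))) (sym stages-word)
    count₀ : ∀ z → count z s₀ ≡ 1
    count₀ z = trans (+-identityʳ _) (trans (cong (δ z x +_) (+-identityʳ (countF z cs))) (once z))
    runs : ∃ λ φ → Run φ (allFin L) stages s₀
    runs = run-total stages (schedule-allFin L) allFin-complete
      (occurrences⇒unique _ (≤-reflexive ∘ indices-complete)) (≤-reflexive ∘ count₀) word₀
    φ : Fin m → Fin L → Bool
    φ = proj₁ runs
    run : Run φ (allFin L) stages s₀
    run = proj₂ runs
    colours : ∀ z → sumOver (λ j → ⟦ φ j z ⟧) (allFin m) ≡ 1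
    colours z = trans (sym (over-stages (λ j → ⟦ φ j z ⟧))) (trans (sym (run-count allFin-complete run z)) (count₀ z))
    B : Fin m → Subset L
    B j = Vec.tabulate (φ j)
    ∈⇒φ : ∀ {j z} → z ∈ₛ B j → φ j z ≡ true
    ∈⇒φ {j} {z} z∈ = trans (sym (Vec.lookup∘tabulate (φ j) z)) (Vec.[]=⇒lookup z∈)
    in-allFin : ∀ j → j ∈ allFin m
    in-allFin j = occurrences⇒∈ (allFin m) (≤-reflexive (sym (allFin-complete j)))
    card : ∀ j → cardinality (φ j) (allFin L) ≡ ∣ B j ∣
    card j = sumOver-tabulate _ id (B j) (λ i → cong ⟦_⟧ (sym (Vec.lookup∘tabulate (φ j) i)))
    budget : Budget {L} (λ j → ∣ B j ∣) 0 stages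
    budget = run-budget (λ j → ∣ B j ∣) card (schedule-allFin L) (≤-reflexive ∘ count₀) word₀ descending run
    beta : Beta l
    beta = record
      { B        = B
      ; disjoint = λ i j i≢j z z∈i z∈j → contradiction
          (subst₂ _≤_ (cong₂ (λ a b → ⟦ a ⟧ + ⟦ b ⟧) (∈⇒φ z∈i) (∈⇒φ z∈j)) (colours z)
            (two-terms-≤ (λ j → ⟦ φ j z ⟧) i≢j (in-allFin i) (in-allFin j)))
          λ { (s≤s ()) }
      ; covering = λ z → let j , le = positive-term (λ j → ⟦ φ j z ⟧) (allFin m) (≤-reflexive (sym (colours z)))
                         in j , Vec.lookup⇒[]= z (B j) (trans (Vec.lookup∘tabulate (φ j) z) (positive (φ j z) le))
      ; bounded  = λ n 1≤n n<m → subst₂ _≤_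
          (sym (sumBelow-highToLow _ n (<⇒≤ n<m))) (sym (sumBelow-highToLow l n (<⇒≤ n<m)))
          (highToLow-sum-bound _ _ m′ (n≤1+n m′) (proj₂ (proj₂ budget)) n (<⇒≤ n<m) (≤-pred n<m)) }
      where
      positive : ∀ b → 1 ≤ ⟦ b ⟧ → b ≡ true
      positive true _ = refl

  from-beta : ∀ b → ∃ λ a → Linked a b
  from-beta β =
    let s , run , none , word-s = run-exists stages b (member-card β) (schedule-allFin L) allFin-complete
                                    (λ z → ≤-reflexive (colours z)) descending budget
        x , cs , s≡ , reads     = single-tree smaller-child w s w-dyck none (trans word-s stages-word)
        run′                    = subst (Run φ (allFin L) stages) s≡ run
        a , corr                = realise x cs reads (λ z → trans (sym (trans (+-identityʳ _) (cong (δ z x +_) (+-identityʳ (countF z cs)))))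
                                    (trans (run-count allFin-complete run′ z) (colours z)))
    in a , x , cs , corr , run′
    where
    open Beta β
    φ : Fin m → Fin L → Bool
    φ = member β
    b : Fin m → ℕ
    b j = ∣ B j ∣
    colours′ : ∀ z → sumOver (λ j → ⟦ φ j z ⟧) (allFin m) ≡ 1
    colours′ z = ≤-antisym
      (at-most-one (λ j → φ j z) (allFin m) (occurrences⇒unique (allFin m) (≤-reflexive ∘ allFin-complete))
        (λ i j i≢j p q → disjoint i j i≢j z (Vec.lookup⇒[]= z (B i) p) (Vec.lookup⇒[]= z (B j) q)))
      (let j , z∈ = covering z in
       subst (_≤ sumOver (λ j → ⟦ φ j z ⟧) (allFin m)) (cong ⟦_⟧ (Vec.[]=⇒lookup z∈))
         (term-≤ (λ j → ⟦ φ j z ⟧) (occurrences⇒∈ (allFin m) (≤-reflexive (sym (allFin-complete j))))))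
    colours : ∀ z → sumOver (λ j → ⟦ φ (proj₂ j) z ⟧) stages ≡ 1
    colours z = trans (over-stages (λ j → ⟦ φ j z ⟧)) (colours′ z)
    -- Double counting: each of the `L` labels lies in exactly one `B j`. The `suc` is the `+ 1` in
    -- `Lsize`.
    total : sumOver b (highToLow m ≤-refl) ≡ suc (sumOver l (highToLow m ≤-refl))
    total = begin
      sumOver b (highToLow m ≤-refl)                              ≡⟨ sumOver-highToLow b ⟩
      sumOver b (allFin m)                                        ≡⟨ sumOver-cong (member-card β) (allFin m) ⟨
      sumOver (λ j → cardinality (φ j) (allFin L)) (allFin m)     ≡⟨ sumOver-swap (λ j y → ⟦ φ j y ⟧) (allFin m) (allFin L) ⟩
      sumOver (λ y → sumOver (λ j → ⟦ φ j y ⟧) (allFin m)) (allFin L) ≡⟨ sumOver-cong colours′ (allFin L) ⟩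
      sumOver (λ _ → 1) (allFin L)                                ≡⟨ sumOver-1 (allFin L) ⟩
      length (allFin L)                                           ≡⟨ length-tabulate id ⟩
      L                                                           ≡⟨ +-comm (sumL l) 1 ⟩
      suc (sumL l)                                                ≡⟨ cong suc sumL-highToLow ⟩
      suc (sumOver l (highToLow m ≤-refl))                        ∎
      where open ≡-Reasoning
    bound : ∀ k (q : k ≤ m) → k ≤ m′ → sumOver b (highToLow k q) ≤ sumOver l (highToLow k q)
    bound zero    q le = z≤n
    bound (suc k) q le = subst₂ _≤_ (sumBelow-highToLow b (suc k) q) (sumBelow-highToLow l (suc k) q)
      (bounded (suc k) (s≤s z≤n) (s≤s le))
    -- The surplus 1 of `total` is the additional letter of the top block, so the run can start
    -- without free letters, that is, with trees only.
    budget : Budget {L} b 0 stages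
    budget = u′ , +-cancelʳ-≡ B′ _ _ (begin
        b top + 0 + B′          ≡⟨ cong (_+ B′) (+-identityʳ (b top)) ⟩
        b top + B′              ≡⟨ total ⟩
        suc (l top) + N         ≡⟨ cong (suc (l top) +_) (trans (+-comm u′ B′) N≡) ⟨
        suc (l top) + (u′ + B′) ≡⟨ +-assoc (suc (l top)) u′ B′ ⟨
        suc (l top) + u′ + B′   ∎)
      , budget-exists b u′ m′ (n≤1+n m′) (λ k q k<m′ → bound k q (<⇒≤ k<m′)) N≡
      where
      open ≡-Reasoning
      B′ = sumOver b (highToLow m′ (n≤1+n m′))
      N  = sumOver l (highToLow m′ (n≤1+n m′))
      u′ = N ∸ B′
      N≡ : B′ + u′ ≡ N
      N≡ = m+[n∸m]≡n (bound m′ (n≤1+n m′) ≤-refl)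

  bijection : Bijection (AlphaSetoid l) (BetaSetoid l)
  bijection = record
    { to        = to
    ; cong      = λ {a} {a′} eq → linked-det {a} {a′} {to a} {to a′} eq (linked a) (linked a′)
    ; bijective = (λ {a} {a′} eq → linked-codet {a} {a′} {to a} {to a′} eq (linked a) (linked a′))
                , λ b → let a , link = from-beta b in
                    a , λ {a′} eq → linked-det {a′} {a} {to a′} {b} eq (linked a′) link }
    where
    to : Alpha l → Beta l
    to a = proj₁ (to-beta a)
    linked : ∀ a → Linked a (to a)
    linked a = proj₂ (to-beta a)

theorem1p4 : (m : ℕ) (l : Fin m → ℕ) →
    1 ≤ m →
    (∀ i → 1 ≤ l i) →
    (∀ i j → i Fin.≤ j → l i ≤ l j) →
    Bijection (AlphaSetoid l) (BetaSetoid l)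
theorem1p4 (suc m′) l _ l≥1 mono = Assembly.bijection l l≥1 mono
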